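{- Let $n\ge 8$ be even and let $G_n$ be the graph obtained from the complete graph $K_n$ by deleting the edges of two vertex-disjoint cycles, each of length $n/2$ (equivalently, $G_n$ is the complement of the disjoint union of two cycles of length $n/2$). Then $G_n$ is not an autograph.
   Context: Let $G=(V,E)$ be a finite simple graph and $S$ a finite multiset of integers. $G$ is an autograph with signature $S$ if there is a bijection $\pi$ from the elements of $S$ (counted with multiplicity) to $V$ such that for any two distinct elements $s,t$ of $S$, the vertices $\pi(s),\pi(t)$ are adjacent if and only if $|s-t|\in S$. -}

module Defs where

open import Data.Nat using (ℕ; suc; _+_; _%_)
open import Data.Fin using (Fin; toℕ)
open import Data.Integer using (ℤ; +_; _-_; ∣_∣)
open import Data.Sum using (_⊎_; inj₁; inj₂)
open import Data.Product using (Σ; ∃; _×_)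
open import Data.Empty using (⊥)
open import Relation.Nullary using (¬_)
open import Relation.Binary.PropositionalEquality using (_≡_; _≢_)
open import Function.Bundles using (_⤖_; Bijection; _⇔_)

-- A graph on vertex type V is given by its adjacency relation.
-- IsAutograph V Adj: there is a finite multiset S of integers, represented as
-- an indexed family S : Fin k → ℤ (elements counted with multiplicity), and a
-- bijection π from the elements of S (i.e. from Fin k) to V such that for any two
-- distinct elements i ≠ j of S, π i and π j are adjacent iff |S i - S j| ∈ S.
IsAutograph : (V : Set) → (V → V → Set) → Set
IsAutograph V Adj =
  Σ ℕ λ k → Σ (Fin k → ℤ) λ S → Σ (Fin k ⤖ V) λ π →
    ∀ (i j : Fin k) → i ≢ j →
      (Adj (Bijection.to π i) (Bijection.to π j)
        ⇔ (∃ λ l → S l ≡ + ∣ S i - S j ∣))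

-- Cycle C_m on vertices Fin m: i ~ j iff j ≡ i + 1 (mod m) or i ≡ j + 1 (mod m).
-- The modulus is written suc m' (so m = suc m') to avoid a NonZero instance.
CycleAdj : (m' : ℕ) → Fin (suc m') → Fin (suc m') → Set
CycleAdj m' i j = (toℕ j ≡ (toℕ i + 1) % suc m') ⊎ (toℕ i ≡ (toℕ j + 1) % suc m')

GVertex : ℕ → Set
GVertex m' = Fin (suc m') ⊎ Fin (suc m')

TwoCyclesAdj : (m' : ℕ) → GVertex m' → GVertex m' → Set
TwoCyclesAdj m' (inj₁ i) (inj₁ j) = CycleAdj m' i j
TwoCyclesAdj m' (inj₂ i) (inj₂ j) = CycleAdj m' i j
TwoCyclesAdj m' _ _ = ⊥

GAdj : (m' : ℕ) → GVertex m' → GVertex m' → Set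
GAdj m' u v = (u ≢ v) × ¬ TwoCyclesAdj m' u v

{-# OPTIONS --safe #-}

-- Let H be the complement of the graph: it is 2-regular, triangle-free and disconnected, and it has
-- at least 8 vertices. If 0 ∈ S, an extremal choice of elements gives a contradiction; if 0 ∉ S, two
-- equal elements of S would be adjacent twins in H, giving a triangle. So S is a set without 0.
--
-- Suppose that S is positive, with least element d, and let a and b be the neighbours of d in H.
-- Then t − d ∈ S for every t ∈ S other than d, a, b, so S consists of three progressions of
-- difference d, starting at d, a and b. Adjacency depends on differences only, hence edges of H can be
-- translated by d as long as no start of a progression is met. Translating the edges at d, 2d, a, b
-- along the progressions always leads to a vertex of degree different from 2.
--
-- Suppose that S has a negative element −x. The largest element M is joined in H to all negative
-- elements, so there are at most two of them. If u is the other neighbour of −x, then t + x ∈ S for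
-- all positive t ∈ S other than M and u. If x ∉ S, then t and t + x are always joined, and H is
-- connected. So x ∈ S, and the few possible neighbours of x lead to a contradiction again.

module Submission where

open import Defs
open import Data.Bool using (Bool; true; false)
open import Data.Empty using (⊥; ⊥-elim)
open import Data.Fin as Fin using (Fin; toℕ; fromℕ; fromℕ<; inject₁)
import Data.Fin.Properties as Finₚ
open import Data.Integer as ℤ using (ℤ; +_; -[1+_]; +<+; 0ℤ; 1ℤ; _+_; _-_; _*_; -_; _<_; ∣_∣)
import Data.Integer.Properties as ℤₚ
open import Data.Integer.Tactic.RingSolver using (solve; solve-∀)
open import Data.List using (List; []; _∷_; _++_; length; lookup; applyUpTo; tabulate)
import Data.List.Membership.DecPropositional as DecMembership
open import Data.List.Membership.Propositional using (_∈_; _∉_)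
open import Data.List.Membership.Propositional.Properties
  using (∈-applyUpTo⁺; ∈-++⁺ˡ; ∈-++⁺ʳ; ∈-tabulate⁺; ∈-tabulate⁻)
open import Data.List.Properties using (length-++; length-applyUpTo)
open import Data.List.Relation.Unary.Any using (Any; here; there; index)
open import Data.List.Relation.Unary.Any.Properties using (lookup-index)
open import Data.Nat as ℕ using (ℕ; zero; suc; _≤_)
open import Data.Nat.DivMod using (_%_; m<n⇒m%n≡m; n%n≡0; m%n<n)
import Data.Nat.Properties as ℕₚ
open import Data.Product using (∃; ∃₂; _×_; _,_; proj₁; proj₂)
open import Data.Sum using (_⊎_; inj₁; inj₂; [_,_])
open import Data.Sum.Properties using (inj₁-injective; inj₂-injective)
open import Function.Bundles using (Bijection; Equivalence)
open import Function.Definitions using (Injective)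
open import Relation.Binary.Definitions using (DecidableEquality; tri<; tri≈; tri>)
open import Relation.Binary.PropositionalEquality
  using (_≡_; _≢_; refl; sym; trans; cong; cong₂; subst)
open import Relation.Nullary using (¬_; Dec; yes; no)
open import Relation.Nullary.Decidable using (¬?; decidable-stable; _⊎-dec_)
open import Relation.Unary using (Decidable)

-- Two moves are iterated. A difference known to be missing from S creates an edge of H between any
-- two elements at that distance; two elements known not to be joined put their distance into S. The
-- second move has two sources: a vertex both of whose neighbours are known, and two neighbours of
-- one vertex, which are not joined because a cycle of length at least 4 has no triangle. The moves
-- stop when a vertex has three neighbours, or only one candidate for a neighbour. The bound of 8
-- elements gives these moves their starting material: when two of the three progressions are short,
-- the third must be long. It is exhausted when 2d is not in S, where 1 + 3 + 3 elements are still
-- too few, so that a or b starts at least four elements. No counting bounds the progressions from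
-- above. When 2d is in S and not joined to b, it helps that b - 2d is in S while b - d is not: some
-- progression ends at b - 2d, which ties b to the other starts.

-- Positivity and linear reasoning over the integers

Pos : ℤ → Set
Pos z = 0ℤ < z

infixl 6 _⊕_
_⊕_ : ∀ {x y} → Pos x → Pos y → Pos (x + y)
_⊕_ = ℤₚ.+-mono-<

Pos-absurd : ∀ {x} → Pos x → x ≢ 0ℤ
Pos-absurd p refl = ℤₚ.<-irrefl refl p

Pos-cong : ∀ {x y} → 0ℤ < x → x ≡ y → 0ℤ < y
Pos-cong p refl = p

-- Discreteness of the integers enters here: a distance that shrinks by a positive step shrinks by
-- at least 1, which pays for one unit of fuel.
Pos-pred : ∀ {x y} → Pos x → Pos y → Pos (x + y - 1ℤ)
Pos-pred {+ suc m} {+ suc n} _ _ rewrite ℕₚ.+-suc m n = +<+ (ℕ.s≤s ℕ.z≤n)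
Pos-pred {+ zero} (+<+ ())
Pos-pred {+ suc _} {+ zero} _ (+<+ ())

sign : ∀ z → Pos z ⊎ z ≡ 0ℤ ⊎ Pos (- z)
sign (+ zero) = inj₂ (inj₁ refl)
sign (+ suc n) = inj₁ (+<+ (ℕ.s≤s ℕ.z≤n))
sign (-[1+ n ]) = inj₂ (inj₂ (+<+ (ℕ.s≤s ℕ.z≤n)))

-- Transitivity with the second equation first, so that the ring solver finds its goal determined.
infixl 4 _after_
_after_ : ∀ {x y z : ℤ} → y ≡ z → x ≡ y → x ≡ z
p after q = trans q p

-- Derives a linear consequence of an equation, leaving to the ring solver only an identity between
-- two differences.
linear : ∀ {x y u v} → x ≡ y → u - v ≡ x - y → u ≡ v
linear {x} refl e = ℤₚ.i-j≡0⇒i≡j _ _ (trans e (solve (x ∷ [])))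

-- Refutes equations: `w` is given as a sum of terms known to be positive, and the solver supplies
-- `x - y ≡ w`.
>⇒≢ : ∀ {x y w} → Pos w → x ≡ y → x - y ≢ w
>⇒≢ {x} p refl e = Pos-absurd p (trans (sym e) (solve (x ∷ [])))

<⇒≢ : ∀ {x y w} → Pos w → x ≡ y → y - x ≢ w
<⇒≢ p e = >⇒≢ p (sym e)

-- The complement graph on the values of the signature

-- Keeping only the positive part of S: the difference of two distinct elements has its absolute
-- value in S exactly when one of its two signed versions lies in Positive P.
record Positive (P : ℤ → Set) (z : ℤ) : Set where
  constructor mkQ
  field
    is-pos : Pos z
    is-in : P z

-- Excluding both signed differences avoids the absolute value and makes it visible that, apart from
-- membership of the ends, the relation is invariant under translation.
record Adjacent (P : ℤ → Set) (x y : ℤ) : Set where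
  constructor mk~
  field
    ∈ˡ : P x
    ∈ʳ : P y
    distinct : x ≢ y
    ∉ˡ : ¬ Positive P (x - y)
    ∉ʳ : ¬ Positive P (y - x)

-- S without repetitions, together with what is used of the complement _~_ of its autograph.
record Config : Set₁ where
  field
    elements : List ℤ

  P : ℤ → Set
  P z = z ∈ elements

  infix 4 _~_
  _~_ : ℤ → ℤ → Set
  _~_ = Adjacent P

  field
    0∉ : ¬ P 0ℤ
    degree : ∀ {x} → P x → ∃₂ λ y z → x ~ y × x ~ z × y ≢ z × (∀ {t} → x ~ t → t ≡ y ⊎ t ≡ z)
    triangle-free : ∀ {x y z} → x ~ y → y ~ z → x ~ z → ⊥
    side : ℤ → Bool
    side-~ : ∀ {x y} → x ~ y → side x ≡ side y
    side-mixed : ∃₂ λ x y → P x × P y × side x ≢ side y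
    fresh : ∀ (xs : List ℤ) → length xs ℕ.< 8 → ∃ λ t → P t × t ∉ xs
    maximum : ∃ λ M → P M × (∀ {t} → P t → t ≡ M ⊎ Pos (M - t))
    minimum : ∃ λ m → P m × (∀ {t} → P t → t ≡ m ⊎ Pos (t - m))

module Graph (C : Config) where
  open Config C public
  open Adjacent public
  open Positive public

  Q : ℤ → Set
  Q = Positive P

  P? : ∀ z → Dec (P z)
  P? z = DecMembership._∈?_ ℤₚ._≟_ z elements

  -- The types of the next two are unfolded so that the ring solver finds its goal determined.
  P-cong : ∀ {x y} → Any (x ≡_) elements → x ≡ y → Any (y ≡_) elements
  P-cong p refl = p

  Q-cong : ∀ {x y} → Positive P x → x ≡ y → Positive P y
  Q-cong p refl = p

  ~-sym : ∀ {x y} → x ~ y → y ~ x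
  ~-sym (mk~ a b c d e) = mk~ b a (λ q → c (sym q)) e d

  Q? : ∀ z → Dec (Q z)
  Q? z with 0ℤ ℤₚ.<? z | P? z
  ... | yes p | yes q = yes (mkQ p q)
  ... | no ¬p | _ = no λ r → ¬p (is-pos r)
  ... | yes _ | no ¬q = no λ r → ¬q (is-in r)

  ≁⇒Q : ∀ {x y} → P x → P y → x ≢ y → ¬ x ~ y → Q (x - y) ⊎ Q (y - x)
  ≁⇒Q {x} {y} px py n ¬a with Q? (x - y) | Q? (y - x)
  ... | yes q | _ = inj₁ q
  ... | no _ | yes q = inj₂ q
  ... | no q | no r = ⊥-elim (¬a (mk~ px py n q r))

  -- `degree` yields an unnamed pair of neighbours; any two distinct neighbours found later must be
  -- that pair.
  full : ∀ {x y z t} → x ~ y → x ~ z → y ≢ z → x ~ t → t ≡ y ⊎ t ≡ z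
  full x~y x~z y≢z x~t with degree (∈ˡ x~y)
  ... | _ , _ , _ , _ , _ , only with only x~y | only x~z | only x~t
  ... | inj₁ refl | inj₁ refl | _ = ⊥-elim (y≢z refl)
  ... | inj₂ refl | inj₂ refl | _ = ⊥-elim (y≢z refl)
  ... | inj₁ refl | inj₂ refl | w = w
  ... | inj₂ refl | inj₁ refl | inj₁ e = inj₂ e
  ... | inj₂ refl | inj₁ refl | inj₂ e = inj₁ e

  degree≤2 : ∀ {x y z t} → x ~ y → x ~ z → x ~ t → y ≢ z → t ≢ y → t ≢ z → ⊥
  degree≤2 p q r y≢z t≢y t≢z = [ t≢y , t≢z ] (full p q y≢z r)

  degree≥2 : ∀ {x y} → P x → (∀ {t} → x ~ t → t ≡ y) → ⊥
  degree≥2 px only with degree px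
  ... | _ , _ , p , q , n , _ = n (trans (only p) (sym (only q)))

  both : ∀ {x y z} → P x → (∀ {t} → x ~ t → t ≡ y ⊎ t ≡ z) → x ~ y × x ~ z
  both px only with degree px
  ... | _ , _ , p , q , n , _ with only p | only q
  ... | inj₁ refl | inj₁ refl = ⊥-elim (n refl)
  ... | inj₂ refl | inj₂ refl = ⊥-elim (n refl)
  ... | inj₁ refl | inj₂ refl = p , q
  ... | inj₂ refl | inj₁ refl = q , p

  other : ∀ {x y} → x ~ y → ∃ λ z → x ~ z × z ≢ y
  other {x} {y} x~y with degree (∈ˡ x~y)
  ... | u , v , p , q , n , _ with u ℤₚ.≟ y
  ... | yes refl = v , q , λ e → n (sym e)
  ... | no m = u , p , m

-- Arithmetic progressions and counting

module Progression (d : ℤ) where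
  -- Recursion on the index makes `up c 3` unfold to `c + d + d + d`, the form in which single
  -- members are written later.
  up : ℤ → ℕ → ℤ
  up c zero = c
  up c (suc n) = up c n + d

  up≡ : ∀ c n → up c n ≡ c + + n * d
  up≡ c zero = eq c d
    where eq : ∀ c d → c ≡ c + 0ℤ * d
          eq = solve-∀
  up≡ c (suc n) = trans (cong (_+ d) (up≡ c n)) (eq c d (+ n))
    where eq : ∀ c d n → c + n * d + d ≡ c + (1ℤ + n) * d
          eq = solve-∀

  Pos-up : ∀ {c} → Pos d → Pos c → ∀ n → Pos (up c n)
  Pos-up pd pc zero = pc
  Pos-up pd pc (suc n) = Pos-up pd pc n ⊕ pd

  up-+ : ∀ c n m → up c (n ℕ.+ suc m) ≡ up c n + up d m
  up-+ c n m = trans (up≡ c (n ℕ.+ suc m))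
    (trans (eq c d (+ n) (+ m)) (sym (cong₂ _+_ (up≡ c n) (up≡ d m))))
    where eq : ∀ c d n m → c + (n + (1ℤ + m)) * d ≡ c + n * d + (d + m * d)
          eq = solve-∀

  up-translate : ∀ c e n → up (c + e) n ≡ up c n + e
  up-translate c e n = trans (up≡ (c + e) n) (trans (eq c d e (+ n)) (sym (cong (_+ e) (up≡ c n))))
    where eq : ∀ c d e n → c + e + n * d ≡ c + n * d + e
          eq = solve-∀

-- S decomposed into arithmetic progressions of difference d, one from each start.
module Chains (C : Config) (d L : ℤ) (d>0 : Pos d)
              (bound : ∀ {t} → Config.P C t → Pos (t - L))
              (s₁ s₂ s₃ : ℤ)
              (descend : ∀ {t} → Config.P C t →
                 t ≡ s₁ ⊎ t ≡ s₂ ⊎ t ≡ s₃ ⊎ Config.P C (t - d)) where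
  open Graph C
  open Progression d

  -- All members up to `t` are required in S, so that one missing member bounds everything reached
  -- from `c`.
  Reach : ℤ → ℤ → Set
  Reach c t = ∃ λ i → t ≡ up c i × (∀ j → j ℕ.≤ i → P (up c j))

  reach-start : ∀ {t} → P t → Reach t t
  reach-start p = 0 , refl , λ { zero _ → p }

  reach-suc : ∀ {c t} → P t → Reach c (t - d) → Reach c t
  reach-suc {c} {t} p (i , e , f) = suc i , e′ , g
    where
    e′ : t ≡ up c i + d
    e′ = cong (_+ d) e after solve (t ∷ d ∷ [])
    g : ∀ j → j ℕ.≤ suc i → P (up c j)
    g j j≤ with ℕₚ.m≤n⇒m<n∨m≡n j≤
    ... | inj₁ (ℕ.s≤s j≤i) = f j j≤i
    ... | inj₂ refl = P-cong p e′

  -- The fuel exceeds `t - L`, which drops by at least 1 with each descent by `d` and stays positive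
  -- on S.
  reach-fuel : ∀ n {t} → P t → Pos (+ n - (t - L)) → Reach s₁ t ⊎ Reach s₂ t ⊎ Reach s₃ t
  reach-fuel zero {t} p q = ⊥-elim (Pos-absurd (q ⊕ bound p) (solve (t ∷ L ∷ [])))
  reach-fuel (suc n) {t} p q with descend p
  ... | inj₁ refl = inj₁ (reach-start p)
  ... | inj₂ (inj₁ refl) = inj₂ (inj₁ (reach-start p))
  ... | inj₂ (inj₂ (inj₁ refl)) = inj₂ (inj₂ (reach-start p))
  ... | inj₂ (inj₂ (inj₂ p′)) with reach-fuel n p′ (Pos-cong (Pos-pred q d>0) (eq (+ n) t L d))
    where eq : ∀ n t L d → 1ℤ + n - (t - L) + d - 1ℤ ≡ n - (t - d - L)
          eq = solve-∀
  ... | inj₁ r = inj₁ (reach-suc p r)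
  ... | inj₂ (inj₁ r) = inj₂ (inj₁ (reach-suc p r))
  ... | inj₂ (inj₂ r) = inj₂ (inj₂ (reach-suc p r))

  reach : ∀ {t} → P t → Reach s₁ t ⊎ Reach s₂ t ⊎ Reach s₃ t
  reach {t} p with t - L in e | bound p
  ... | + n | _ = reach-fuel (suc n) p
        (Pos-cong (+<+ (ℕ.s≤s (ℕ.z≤n {0}))) (trans (eq (+ n)) (cong (λ z → 1ℤ + + n - z) (sym e))))
    where eq : ∀ n → 1ℤ ≡ 1ℤ + n - n
          eq = solve-∀

  Reach⇒∈ : ∀ {c t n} → ¬ P (up c n) → Reach c t → t ∈ applyUpTo (up c) n
  Reach⇒∈ {c} {n = n} ¬p (i , refl , f) with n ℕₚ.≤? i
  ... | yes n≤i = ⊥-elim (¬p (f n n≤i))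
  ... | no n≰i = ∈-applyUpTo⁺ (up c) (ℕₚ.≰⇒> n≰i)

  -- Each progression stops before its missing member, so S would have at most `i + j + k` elements.
  too-short : ∀ i j k → i ℕ.+ (j ℕ.+ k) ℕ.< 8 → ¬ P (up s₁ i) → ¬ P (up s₂ j) → ¬ P (up s₃ k) → ⊥
  too-short i j k lt ¬i ¬j ¬k with fresh xs (subst (ℕ._< 8) (sym len) lt)
    where
    xs = applyUpTo (up s₁) i ++ applyUpTo (up s₂) j ++ applyUpTo (up s₃) k
    len : length xs ≡ i ℕ.+ (j ℕ.+ k)
    len = trans (length-++ (applyUpTo (up s₁) i))
      (cong₂ ℕ._+_ (length-applyUpTo (up s₁) i)
        (trans (length-++ (applyUpTo (up s₂) j))
          (cong₂ ℕ._+_ (length-applyUpTo (up s₂) j) (length-applyUpTo (up s₃) k))))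
  ... | t , p , t∉ with reach p
  ... | inj₁ r = t∉ (∈-++⁺ˡ (Reach⇒∈ {n = i} ¬i r))
  ... | inj₂ (inj₁ r) = t∉ (∈-++⁺ʳ (applyUpTo (up s₁) i) (∈-++⁺ˡ (Reach⇒∈ {n = j} ¬j r)))
  ... | inj₂ (inj₂ r) = t∉ (∈-++⁺ʳ (applyUpTo (up s₁) i) (∈-++⁺ʳ (applyUpTo (up s₂) j) (Reach⇒∈ {n = k} ¬k r)))

  long-enough : ∀ i j k → i ℕ.+ (j ℕ.+ k) ℕ.< 8 → ¬ P (up s₁ i) → ¬ P (up s₂ j) → P (up s₃ k)
  long-enough i j k lt ¬i ¬j with P? (up s₃ k)
  ... | yes p = p
  ... | no ¬k = ⊥-elim (too-short i j k lt ¬i ¬j ¬k)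

-- Positive signatures

pattern case₁ x = inj₁ x
pattern case₂ x = inj₂ (inj₁ x)
pattern case₃ x = inj₂ (inj₂ (inj₁ x))
pattern case₄ x = inj₂ (inj₂ (inj₂ x))

module PositiveCase (C : Config) (positive : ∀ {t} → Config.P C t → Pos t) where
  open Graph C

  record Starts (d a b : ℤ) : Set where
    field
      d-least : ∀ {t} → P t → t ≡ d ⊎ Pos (t - d)
      d~a : d ~ a
      d~b : d ~ b
      a≢b : a ≢ b

  swap-starts : ∀ {d a b} → Starts d a b → Starts d b a
  swap-starts s = record { d-least = d-least ; d~a = d~b ; d~b = d~a ; a≢b = λ e → a≢b (sym e) }
    where open Starts s

  difference∈ˡ : ∀ {x y w} → P w → x ~ y → x - y ≢ w
  difference∈ˡ p x~y e = ∉ˡ x~y (Q-cong (mkQ (positive p) p) (sym e))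

  difference∈ʳ : ∀ {x y w} → P w → x ~ y → y - x ≢ w
  difference∈ʳ p x~y e = ∉ʳ x~y (Q-cong (mkQ (positive p) p) (sym e))

  module Facts {d a b} (s : Starts d a b) where
    open Starts s public

    d∈ : P d
    d∈ = ∈ˡ d~a
    a∈ : P a
    a∈ = ∈ʳ d~a
    b∈ : P b
    b∈ = ∈ʳ d~b
    d>0 : Pos d
    d>0 = positive d∈

    a-d>0 : Pos (a - d)
    a-d>0 with d-least a∈
    ... | inj₁ e = ⊥-elim (distinct d~a (sym e))
    ... | inj₂ p = p

    b-d>0 : Pos (b - d)
    b-d>0 with d-least b∈
    ... | inj₁ e = ⊥-elim (distinct d~b (sym e))
    ... | inj₂ p = p

    a-d∉ : ¬ P (a - d)
    a-d∉ p = ∉ʳ d~a (mkQ a-d>0 p)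

    b-d∉ : ¬ P (b - d)
    b-d∉ p = ∉ʳ d~b (mkQ b-d>0 p)

    below : ∀ {t w} → P t → Pos w → d - t ≢ w
    below {t} p w>0 e with d-least p
    ... | inj₁ refl = >⇒≢ w>0 (refl {x = t}) e
    ... | inj₂ q = Pos-absurd (q ⊕ w>0) (trans (cong (λ w → t - d + w) (sym e)) (solve (t ∷ d ∷ [])))

    a~d : a ~ d
    a~d = ~-sym d~a
    b~d : b ~ d
    b~d = ~-sym d~b

    descend : ∀ {t} → P t → t ≡ d ⊎ t ≡ a ⊎ t ≡ b ⊎ P (t - d)
    descend {t} p with t ℤₚ.≟ d | Q? (t - d)
    ... | yes e | _ = case₁ e
    ... | no _ | yes (mkQ _ q) = case₄ q
    ... | no n | no q with full d~a d~b a≢b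
          (mk~ d∈ p (λ e → n (sym e)) (λ (mkQ _ r) → below r (positive p) (solve (d ∷ t ∷ []))) q)
    ... | inj₁ e = case₂ e
    ... | inj₂ e = case₃ e

    open Progression d public
    open Chains C d 0ℤ d>0 (λ {t} p → Pos-cong (positive p) (sym (ℤₚ.+-identityʳ t))) d a b descend public

    -- Adjacency depends on differences only, so it is carried from y + d down to y unless the
    -- neighbour is a start.
    shift : ∀ {y t} → P y → y + d ~ t → t ≡ a ⊎ t ≡ b ⊎ ∃ λ u → t ≡ u + d × y ~ u
    shift {y} {t} y∈ adj with descend (∈ʳ adj)
    ... | case₁ refl = ⊥-elim (difference∈ˡ y∈ adj (solve (y ∷ d ∷ [])))
    ... | case₂ e = inj₁ e
    ... | case₃ e = inj₂ (inj₁ e)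
    ... | case₄ p = inj₂ (inj₂ (t - d , solve (t ∷ d ∷ []) , mk~ y∈ p
            (λ e → distinct adj (linear e (solve (t ∷ y ∷ d ∷ []))))
            (λ q → ∉ˡ adj (Q-cong q (solve (y ∷ t ∷ d ∷ []))))
            (λ q → ∉ʳ adj (Q-cong q (solve (y ∷ t ∷ d ∷ []))))))

    shift-full : ∀ {y p q t} → y ~ p → y ~ q → p ≢ q → y + d ~ t →
                 t ≡ a ⊎ t ≡ b ⊎ t ≡ p + d ⊎ t ≡ q + d
    shift-full y~p y~q p≢q adj with shift (∈ˡ y~p) adj
    ... | case₁ e = case₁ e
    ... | case₂ e = case₂ e
    ... | inj₂ (inj₂ (u , e , y~u)) with full y~p y~q p≢q y~u
    ... | inj₁ refl = case₃ e
    ... | inj₂ refl = case₄ e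

    -- `w` is the amount by which `x - y` falls short of the least element `d`, so only the
    -- difference `y - x` needs testing.
    adj⁺ : ∀ {x y v w} → P x → P y → x ≢ y → ¬ P v → y - x ≡ v → Pos w → d - (x - y) ≡ w → Adjacent P x y
    adj⁺ x∈ y∈ n v∉ e w>0 f =
      mk~ x∈ y∈ n (λ q → below (is-in q) w>0 f) (λ q → v∉ (P-cong (is-in q) e))

    ≁⇒∈ : ∀ {x y} → P x → P y → x ≢ y → ¬ x ~ y → P (x - y) ⊎ P (y - x)
    ≁⇒∈ x∈ y∈ n ¬adj with ≁⇒Q x∈ y∈ n ¬adj
    ... | inj₁ q = inj₁ (is-in q)
    ... | inj₂ q = inj₂ (is-in q)

    ≁⇒∈⁺ : ∀ {x y w} → P x → P y → x ≢ y → ¬ x ~ y → Pos w → d - (x - y) ≡ w → P (y - x)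
    ≁⇒∈⁺ x∈ y∈ n ¬adj w>0 e with ≁⇒∈ x∈ y∈ n ¬adj
    ... | inj₁ q = ⊥-elim (below q w>0 e)
    ... | inj₂ q = q

    d≢2d : d ≢ d + d
    d≢2d = λ e → <⇒≢ d>0 e (solve (d ∷ []))
    3d≢d : d + d + d ≢ d
    3d≢d = λ e → >⇒≢ (d>0 ⊕ d>0) e (solve (d ∷ []))
    3d≢2d : d + d + d ≢ d + d
    3d≢2d = λ e → >⇒≢ d>0 e (solve (d ∷ []))

    a+d≢a : a + d ≢ a
    a+d≢a = λ e → >⇒≢ d>0 e (solve (a ∷ d ∷ []))

    a+d≢b : a + d ≢ b
    a+d≢b e = b-d∉ (P-cong a∈ (linear e (solve (a ∷ b ∷ d ∷ []))))

    2d≢a+d : d + d ≢ a + d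
    2d≢a+d = λ e → <⇒≢ a-d>0 e (solve (a ∷ d ∷ []))

    2d~a+d : P (d + d) → P (a + d) → d + d ~ a + d
    2d~a+d p q = adj⁺ p q 2d≢a+d a-d∉ (solve (a ∷ d ∷ [])) (positive a∈) (solve (a ∷ d ∷ []))

    a≢2d : P (d + d) → a ≢ d + d
    a≢2d p e = a-d∉ (P-cong d∈ (linear (sym e) (solve (a ∷ d ∷ []))))

    two-neighbours : P (d + d) → ∀ {t} → d + d ~ t → t ≡ a ⊎ t ≡ b ⊎ t ≡ a + d ⊎ t ≡ b + d
    two-neighbours p = shift-full d~a d~b a≢b

  -- Positive signatures containing 2d

  -- second-p-q: the neighbours of 2d in H are not p and q.
  second-a-b : ∀ {d a b} → Starts d a b → d + d ~ a → d + d ~ b → ⊥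
  second-a-b {d} {a} {b} s 2~a 2~b = go (P? (d + d + d))
    where
    open Facts s
    module S = Facts (swap-starts s)
    a+d∉ : ¬ P (a + d)
    a+d∉ p = degree≤2 2~a 2~b (2d~a+d (∈ˡ 2~a) p) a≢b a+d≢a a+d≢b
    b+d∉ : ¬ P (b + d)
    b+d∉ p = degree≤2 2~a 2~b (S.2d~a+d (∈ˡ 2~a) p) a≢b S.a+d≢b S.a+d≢a
    go : Dec (P (d + d + d)) → ⊥
    go (no 3∉) = too-short 2 1 1 (ℕₚ.m≤m+n 5 3) 3∉ a+d∉ b+d∉
    go (yes 3∈) with degree 3∈
    ... | t , _ , 3~t , _ with shift-full 2~a 2~b a≢b 3~t
    ... | case₁ refl = degree≤2 a~d (~-sym 2~a) (~-sym 3~t) d≢2d 3d≢d 3d≢2d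
    ... | case₂ refl = degree≤2 b~d (~-sym 2~b) (~-sym 3~t) d≢2d 3d≢d 3d≢2d
    ... | case₃ refl = a+d∉ (∈ʳ 3~t)
    ... | case₄ refl = b+d∉ (∈ʳ 3~t)

  -- If 3d is in S, its neighbours must be b and b + 2d, and then b - 2d can neither be a start nor
  -- have a predecessor. If not, nearly all of S lies over b, and b + 2d keeps one candidate for a
  -- neighbour.
  second-a-b+d : ∀ {d a b} → Starts d a b → d + d ~ a → d + d ~ b + d → ⊥
  second-a-b+d {d} {a} {b} s 2~a 2~b+d = go (P? (d + d + d))
    where
    open Facts s
    module S = Facts (swap-starts s)
    2∈ : P (d + d)
    2∈ = ∈ˡ 2~a
    a~2 : a ~ d + d
    a~2 = ~-sym 2~a
    a+d∉ : ¬ P (a + d)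
    a+d∉ p = degree≤2 2~a 2~b+d (2d~a+d 2∈ p) (λ e → S.a+d≢b (sym e)) a+d≢a
               (λ e → a≢b (linear e (solve (a ∷ b ∷ d ∷ []))))
    2≁b : ¬ d + d ~ b
    2≁b 2~b = degree≤2 2~a 2~b+d 2~b (λ e → S.a+d≢b (sym e)) (λ e → a≢b (sym e))
               (λ e → S.a+d≢a (sym e))
    b-2∈ : P (b - (d + d))
    b-2∈ = ≁⇒∈⁺ 2∈ b∈ (λ e → S.a≢2d 2∈ (sym e)) 2≁b b-d>0 (solve (b ∷ d ∷ []))
    a-2∉ : ¬ P (a - (d + d))
    a-2∉ p = difference∈ʳ p 2~a refl
    -- The neighbours of a are d and 2d, so its distance 4d to b + 2d lies in S. Then 4d is a third
    -- neighbour of b, since b - 4d = a - 2d is missing.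
    impossible-gap : P (d + d + d) → b ≡ a + d + d → d + d + d ~ b → P (b + d + d) → ⊥
    impossible-gap 3∈ refl 3~b b+2∈ =
      degree≤2 b~d (~-sym 3~b) (~-sym 4~b) (λ e → 3d≢d (sym e))
        (λ e → >⇒≢ (d>0 ⊕ d>0 ⊕ d>0) e (solve (d ∷ [])))
        (λ e → >⇒≢ d>0 e (solve (d ∷ [])))
      where
      a≁ : ¬ a ~ a + d + d + d + d
      a≁ adj = degree≤2 a~d a~2 adj d≢2d
        (λ e → >⇒≢ (a-d>0 ⊕ d>0 ⊕ d>0 ⊕ d>0 ⊕ d>0) e (solve (a ∷ d ∷ [])))
        (λ e → >⇒≢ (a-d>0 ⊕ d>0 ⊕ d>0 ⊕ d>0) e (solve (a ∷ d ∷ [])))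
      4∈ : P (d + d + d + d)
      4∈ = P-cong (≁⇒∈⁺ a∈ b+2∈ (λ e → <⇒≢ (d>0 ⊕ d>0 ⊕ d>0 ⊕ d>0) e (solve (a ∷ d ∷ []))) a≁
             (d>0 ⊕ d>0 ⊕ d>0 ⊕ d>0 ⊕ d>0) (solve (a ∷ d ∷ []))) (solve (a ∷ d ∷ []))
      4~b : d + d + d + d ~ a + d + d
      4~b = adj⁺ 4∈ b∈ (λ e → b-d∉ (P-cong 3∈ (linear e (solve (a ∷ d ∷ []))))) a-2∉
              (solve (a ∷ d ∷ [])) a-d>0 (solve (a ∷ d ∷ []))
    go : Dec (P (d + d + d)) → ⊥
    go (yes 3∈) = finish (both 3∈ options)
      where
      options : ∀ {t} → d + d + d ~ t → t ≡ b ⊎ t ≡ b + d + d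
      options 3~t with shift-full 2~a 2~b+d (λ e → S.a+d≢b (sym e)) 3~t
      ... | case₁ refl = ⊥-elim (degree≤2 a~d a~2 (~-sym 3~t) d≢2d 3d≢d 3d≢2d)
      ... | case₂ e = inj₁ e
      ... | case₃ refl = ⊥-elim (a+d∉ (∈ʳ 3~t))
      ... | case₄ e = inj₂ e
      finish : d + d + d ~ b × d + d + d ~ b + d + d → ⊥
      finish (3~b , 3~b+2) = start (descend b-2∈)
        where
        start : b - (d + d) ≡ d ⊎ b - (d + d) ≡ a ⊎ b - (d + d) ≡ b ⊎ P (b - (d + d) - d) → ⊥
        start (case₁ e) = b-d∉ (P-cong 2∈ (linear (sym e) (solve (b ∷ d ∷ []))))
        start (case₂ e) = impossible-gap 3∈ (linear e (solve (a ∷ b ∷ d ∷ []))) 3~b (∈ʳ 3~b+2)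
        start (case₃ e) = <⇒≢ (d>0 ⊕ d>0) e (solve (b ∷ d ∷ []))
        start (case₄ p) = difference∈ʳ p 3~b (solve (b ∷ d ∷ []))
    go (no 3∉) = degree≥2 (chain 2 (ℕₚ.m≤m+n 6 2)) only
      where
      -- Only d, 2d and a lie outside the progression from b, which therefore has at least five
      -- members.
      chain : ∀ j → 2 ℕ.+ (1 ℕ.+ j) ℕ.< 8 → P (up b j)
      chain j lt = long-enough 2 1 j lt 3∉ a+d∉
      b+1~b+4 : b + d ~ b + d + d + d + d
      b+1~b+4 = adj⁺ (chain 1 (ℕₚ.m≤m+n 5 3)) (chain 4 (ℕₚ.m≤m+n 8 0))
        (λ e → <⇒≢ (d>0 ⊕ d>0 ⊕ d>0) e (solve (b ∷ d ∷ []))) 3∉ (solve (b ∷ d ∷ []))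
        (d>0 ⊕ d>0 ⊕ d>0 ⊕ d>0) (solve (b ∷ d ∷ []))
      2≢b+4 : d + d ≢ b + d + d + d + d
      2≢b+4 e = <⇒≢ (b-d>0 ⊕ d>0 ⊕ d>0 ⊕ d>0) e (solve (b ∷ d ∷ []))
      a≁b+2 : ¬ a ~ b + d + d
      a≁b+2 adj = degree≤2 a~d a~2 adj d≢2d
        (λ e → >⇒≢ (b-d>0 ⊕ d>0 ⊕ d>0) e (solve (b ∷ d ∷ [])))
        (λ e → >⇒≢ (b-d>0 ⊕ d>0) e (solve (b ∷ d ∷ [])))
      b+2≁b : ¬ b + d + d ~ b
      b+2≁b adj = difference∈ˡ 2∈ adj (solve (b ∷ d ∷ []))
      options : ∀ {t} → b + d + d ~ t → t ≡ a ⊎ t ≡ b ⊎ t ≡ d + d + d ⊎ t ≡ b + d + d + d + d + d →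
                t ≡ b + d + d + d + d + d
      options adj (case₁ refl) = ⊥-elim (a≁b+2 (~-sym adj))
      options adj (case₂ refl) = ⊥-elim (b+2≁b adj)
      options adj (case₃ refl) = ⊥-elim (3∉ (∈ʳ adj))
      options adj (case₄ e) = e
      only : ∀ {t} → b + d + d ~ t → t ≡ b + d + d + d + d + d
      only adj = options adj (shift-full (~-sym 2~b+d) b+1~b+4 2≢b+4 adj)

  -- Now a has the neighbours d and 2d, so its distance to every other element is in S. The proof
  -- then asks which progression ends at b - 2d.
  second-a-a+d : ∀ {d a b} → Starts d a b → d + d ~ a → d + d ~ a + d → ⊥
  second-a-a+d {d} {a} {b} s 2~a 2~a+d = [ third , no-third ] (third? (P? (d + d + d)))
    where
    open Facts s
    module S = Facts (swap-starts s)
    third? : Dec (P (d + d + d)) → P (d + d + d) ⊎ ¬ P (d + d + d)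
    third? (yes p) = inj₁ p
    third? (no p) = inj₂ p

    2∈ : P (d + d)
    2∈ = ∈ˡ 2~a
    a~2d : a ~ d + d
    a~2d = ~-sym 2~a
    a≢a+d : a ≢ a + d
    a≢a+d e = a+d≢a (sym e)
    b+d∉ : ¬ P (b + d)
    b+d∉ p = degree≤2 2~a 2~a+d (S.2d~a+d 2∈ p) a≢a+d S.a+d≢b
               (λ e → a≢b (linear (sym e) (solve (a ∷ b ∷ d ∷ []))))
    2≁b : ¬ d + d ~ b
    2≁b 2~b = degree≤2 2~a 2~a+d 2~b a≢a+d (λ e → a≢b (sym e)) (λ e → a+d≢b (sym e))
    b-2d∈ : P (b - (d + d))
    b-2d∈ = ≁⇒∈⁺ 2∈ b∈ (λ e → S.a≢2d 2∈ (sym e)) 2≁b b-d>0 (solve (b ∷ d ∷ []))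
    a-2d∉ : ¬ P (a - (d + d))
    a-2d∉ p = difference∈ʳ p 2~a refl
    ≁a : ∀ {t} → t ~ a → t ≢ d → t ≢ d + d → ⊥
    ≁a adj n m = degree≤2 a~d a~2d (~-sym adj) d≢2d n m

    -- Only d, 2d and b lie outside the progression from a, so a + 3d is in S and becomes a third
    -- neighbour of a.
    no-third : ¬ P (d + d + d) → ⊥
    no-third 3∉ = degree≤2 a~d a~2d a~a+3d d≢2d
        (λ e → >⇒≢ (a-d>0 ⊕ d>0 ⊕ d>0 ⊕ d>0) e (solve (a ∷ d ∷ [])))
        (λ e → >⇒≢ (a-d>0 ⊕ d>0 ⊕ d>0) e (solve (a ∷ d ∷ [])))
      where
      a~a+3d : a ~ a + d + d + d
      a~a+3d = adj⁺ a∈ (S.long-enough 2 1 3 (ℕₚ.m≤m+n 7 1) 3∉ b+d∉)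
        (λ e → <⇒≢ (d>0 ⊕ d>0 ⊕ d>0) e (solve (a ∷ d ∷ []))) 3∉ (solve (a ∷ d ∷ []))
        (d>0 ⊕ d>0 ⊕ d>0 ⊕ d>0) (solve (a ∷ d ∷ []))

    -- b − 2d = a + y is the last element of the progression starting at a.
    b-2d-ends-a : P (d + d + d) → ∀ {y} → Pos y → P (a + y - d) → P (a + y) → b ≡ a + y + (d + d) → ⊥
    b-2d-ends-a 3∈ {y} y>0 T′∈ T∈ b≡ = degree≥2 y+2d∈ (λ adj → options adj (shift-full y+d~T′ y+d~T T′≢T adj))
      where
      b-a≡y+2d : b - a ≡ y + d + d
      b-a≡y+2d = linear b≡ (solve (a ∷ b ∷ d ∷ y ∷ []))
      y+2d∈ : P (y + d + d)
      y+2d∈ = P-cong (≁⇒∈⁺ a∈ b∈ a≢b (λ adj → triangle-free d~a adj d~b) (d>0 ⊕ y>0 ⊕ d>0 ⊕ d>0)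
             (linear b≡ (solve (a ∷ b ∷ d ∷ y ∷ [])))) b-a≡y+2d
      T≁a : ¬ a + y ~ a
      T≁a adj = ≁a adj (λ e → >⇒≢ (a-d>0 ⊕ y>0) e (solve (a ∷ y ∷ d ∷ [])))
               (λ e → b≢4d (trans b≡ (cong (_+ (d + d)) e)))
        where
        b≢4d : b ≢ d + d + (d + d)
        b≢4d e = b-d∉ (P-cong 3∈ (linear (sym e) (solve (b ∷ d ∷ []))))
      y∈ : P y
      y∈ = P-cong (≁⇒∈⁺ a∈ T∈ (λ e → <⇒≢ y>0 e (solve (a ∷ y ∷ []))) (λ adj → T≁a (~-sym adj)) (d>0 ⊕ y>0)
             (solve (a ∷ y ∷ d ∷ []))) (solve (a ∷ y ∷ []))
      y+d∈ : P (y + d)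
      y+d∈ = start (descend y+2d∈)
        where
        start : y + d + d ≡ d ⊎ y + d + d ≡ a ⊎ y + d + d ≡ b ⊎ P (y + d + d - d) → P (y + d)
        start (case₁ e) = ⊥-elim (>⇒≢ (y>0 ⊕ d>0) e (solve (y ∷ d ∷ [])))
        start (case₂ e) = ⊥-elim (a-2d∉ (P-cong y∈ (linear e (solve (a ∷ y ∷ d ∷ [])))))
        start (case₃ e) = ⊥-elim (<⇒≢ (positive a∈) (trans e b≡) (solve (a ∷ y ∷ d ∷ [])))
        start (case₄ p) = P-cong p (solve (y ∷ d ∷ []))
      -- The distances from y + d to a + y and a + y - d are a - d and a - 2d, both missing from S.
      -- Translating these two edges leaves y + 2d with the single candidate a + y.
      y+d~T : y + d ~ a + y
      y+d~T = adj⁺ y+d∈ T∈ (λ e → <⇒≢ a-d>0 e (solve (a ∷ y ∷ d ∷ []))) a-d∉ (solve (a ∷ y ∷ d ∷ []))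
                (positive a∈) (solve (a ∷ y ∷ d ∷ []))
      y+d~T′ : y + d ~ a + y - d
      y+d~T′ = adj⁺ y+d∈ T′∈ (λ e → a≢2d 2∈ (linear (sym e) (solve (a ∷ y ∷ d ∷ [])))) a-2d∉
                 (solve (a ∷ y ∷ d ∷ [])) a-d>0 (solve (a ∷ y ∷ d ∷ []))
      T′≢T : a + y - d ≢ a + y
      T′≢T e = <⇒≢ d>0 e (solve (a ∷ y ∷ d ∷ []))
      options : ∀ {t} → y + d + d ~ t → t ≡ a ⊎ t ≡ b ⊎ t ≡ a + y - d + d ⊎ t ≡ a + y + d → t ≡ a + y
      options adj (case₁ refl) = ⊥-elim (≁a adj (λ e → >⇒≢ (y>0 ⊕ d>0) e (solve (y ∷ d ∷ [])))
                                            (λ e → >⇒≢ y>0 e (solve (y ∷ d ∷ []))))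
      options adj (case₂ refl) = ⊥-elim (difference∈ʳ a∈ adj (linear b≡ (solve (a ∷ b ∷ y ∷ d ∷ []))))
      options adj (case₃ e) = trans e (solve (a ∷ y ∷ d ∷ []))
      options adj (case₄ refl) = ⊥-elim (b-d∉ (P-cong (∈ʳ adj) (linear (sym b≡) (solve (a ∷ b ∷ y ∷ d ∷ [])))))

    third : P (d + d + d) → ⊥
    third 3∈ = end (reach b-2d∈)
      where
      a≁3d : ¬ d + d + d ~ a
      a≁3d adj = ≁a adj 3d≢d 3d≢2d
      a≢3d : a ≢ d + d + d
      a≢3d e = a-d∉ (P-cong 2∈ (linear (sym e) (solve (a ∷ d ∷ []))))

      -- Here b − 2d is the last element of the progression starting at d.
      module B-2d-ends-d (m : ℕ) (b≡ : b - (d + d) ≡ up d (suc m)) (low : ∀ j → j ℕ.≤ suc m → P (up d j)) where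
        -- The edges of H through d, a, 2d, a + d, 3d, … form a zigzag path.
        record Zigzag (j : ℕ) : Set where
          field
            low~ : up d j ~ up a j
            mid~ : up d (suc j) ~ up a j
            high~ : up d (suc j) ~ up a (suc j)
        open Zigzag

        low≢mid : ∀ {t} → t ≢ t + d
        low≢mid {t} e = <⇒≢ d>0 e (solve (t ∷ d ∷ []))

        -- Here b = (m + 4) d, so its distances to the progression from d are again multiples of d.
        b-up : ∀ j r → j ℕ.+ suc r ≡ suc (suc (suc m)) → b - up d j ≡ up d r
        b-up j r e = trans (eq b d (up d j)) (trans (cong (λ z → z + (d + d) - up d j) b≡)
            (trans (cong (_- up d j) (trans (eq′ (up d (suc m)) d) (trans (cong (up d) (sym e)) (up-+ d j r))))
              (eq″ (up d j) (up d r))))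
          where
          eq : ∀ b d u → b - u ≡ b - (d + d) + (d + d) - u
          eq = solve-∀
          eq′ : ∀ u d → u + (d + d) ≡ u + d + d
          eq′ = solve-∀
          eq″ : ∀ u v → u + v - u ≡ v
          eq″ = solve-∀

        zigzag : ∀ j → j ℕ.≤ m → Zigzag j
        zigzag zero _ = record { low~ = d~a ; mid~ = 2~a ; high~ = 2~a+d }
        zigzag (suc j) j<m = step (both (low (suc (suc j)) (ℕ.s≤s j<m)) (λ adj → options adj (shift-full (mid~ z) (high~ z) low≢mid adj)))
          where
          z : Zigzag j
          z = zigzag j (ℕₚ.<⇒≤ j<m)
          r : ℕ
          r = m ℕ.∸ suc j
          r≡ : suc (suc j) ℕ.+ suc (suc r) ≡ suc (suc (suc m))
          r≡ = cong (λ k → suc k) (trans (ℕₚ.+-suc (suc j) (suc r)) (cong suc (trans (ℕₚ.+-suc (suc j) r) (cong suc (ℕₚ.m+[n∸m]≡n j<m)))))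
          y∈>0 : Pos (up d j)
          y∈>0 = positive (∈ˡ (low~ z))
          options : ∀ {t} → up d (suc (suc j)) ~ t → t ≡ a ⊎ t ≡ b ⊎ t ≡ up a j + d ⊎ t ≡ up a (suc j) + d →
                    t ≡ up a (suc j) ⊎ t ≡ up a (suc (suc j))
          options adj (case₁ refl) = ⊥-elim (≁a adj (λ e → >⇒≢ (y∈>0 ⊕ d>0) e (eq (up d j) d))
                                                (λ e → >⇒≢ y∈>0 e (eq′ (up d j) d)))
            where
            eq : ∀ u d → u + d + d - d ≡ u + d
            eq = solve-∀
            eq′ : ∀ u d → u + d + d - (d + d) ≡ u
            eq′ = solve-∀
          options adj (case₂ refl) = ⊥-elim (difference∈ʳ (low (suc r) (ℕ.s≤s (ℕₚ.m∸n≤m m (suc j)))) adj (b-up (suc (suc j)) (suc r) r≡))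
          options adj (case₃ e) = inj₁ e
          options adj (case₄ e) = inj₂ e
          step : up d (suc (suc j)) ~ up a (suc j) × up d (suc (suc j)) ~ up a (suc (suc j)) → Zigzag (suc j)
          step (p , q) = record { low~ = high~ z ; mid~ = p ; high~ = q }

        -- The zigzag cannot continue because (m + 3) d = b - d is missing; a + (m + 1) d is left
        -- with the one neighbour (m + 2) d.
        contradiction : ⊥
        contradiction = degree≥2 (∈ʳ (high~ z)) (λ adj → options adj (shift-full (~-sym (low~ z)) (~-sym (mid~ z)) low≢mid adj))
          where
          z : Zigzag m
          z = zigzag m ℕₚ.≤-refl
          A D : ℤ
          A = up a m
          D = up d m
          b≡D : b ≡ D + d + d + d
          b≡D = linear b≡ (eq b d D)
            where eq : ∀ b d u → b - (u + d + d + d) ≡ b - (d + d) - (u + d)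
                  eq = solve-∀
          A≡D : A ≡ D + (a - d)
          A≡D = trans (cong (λ c → up c m) (eq a d)) (up-translate d (a - d) m)
            where eq : ∀ a d → a ≡ d + (a - d)
                  eq = solve-∀
          options : ∀ {t} → A + d ~ t → t ≡ a ⊎ t ≡ b ⊎ t ≡ D + d ⊎ t ≡ D + d + d → t ≡ D + d
          options adj (case₁ refl) = ⊥-elim (difference∈ˡ (low m (ℕₚ.n≤1+n m)) adj
              (linear A≡D (eq a d A D)))
            where eq : ∀ a d A D → A + d - a - D ≡ A - (D + (a - d))
                  eq = solve-∀
          -- The distance from A + d to b equals that from 3d to a, which is in S because 3d and a
          -- are not joined.
          options adj (case₂ refl) = far (≁⇒∈ 3∈ a∈ (λ e → a≢3d (sym e)) a≁3d)
            where
            e₁ : b - (A + d) ≡ d + d + d - a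
            e₁ = linear (cong₂ _-_ b≡D A≡D) (eq a b d A D)
              where eq : ∀ a b d A D → b - (A + d) - (d + d + d - a) ≡ b - A - (D + d + d + d - (D + (a - d)))
                    eq = solve-∀
            e₂ : A + d - b ≡ a - (d + d + d)
            e₂ = linear (cong₂ _-_ A≡D b≡D) (eq a b d A D)
              where eq : ∀ a b d A D → A + d - b - (a - (d + d + d)) ≡ A - b - (D + (a - d) - (D + d + d + d))
                    eq = solve-∀
            far : ∀ {t} → P (d + d + d - a) ⊎ P (a - (d + d + d)) → t
            far (inj₁ p) = ⊥-elim (difference∈ʳ p adj e₁)
            far (inj₂ p) = ⊥-elim (difference∈ˡ p adj e₂)
          options adj (case₃ e) = e
          options adj (case₄ refl) = ⊥-elim (b-d∉ (P-cong (∈ʳ adj) (linear (sym b≡D) (eq b d D))))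
            where eq : ∀ b d D → D + d + d - (b - d) ≡ D + d + d + d - b
                  eq = solve-∀

      end : Reach d (b - (d + d)) ⊎ Reach a (b - (d + d)) ⊎ Reach b (b - (d + d)) → ⊥
      end (inj₁ (zero , e , _)) = b-d∉ (P-cong 2∈ (linear {d} (sym e) (solve (b ∷ d ∷ []))))
      end (inj₁ (suc m , e , low)) = B-2d-ends-d.contradiction m e low
      end (inj₂ (inj₁ (zero , e , _))) = b-d∉ (P-cong (∈ʳ 2~a+d) (linear {a} (sym e) (solve (a ∷ b ∷ d ∷ []))))
      end (inj₂ (inj₁ (suc i , e , low))) =
        b-2d-ends-a 3∈ (Pos-up d>0 d>0 i)
          (P-cong (low i (ℕₚ.n≤1+n i)) (linear (up-+ a 0 i) (eq₁ a d (up a i) (up d i))))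
          (P-cong (low (suc i) ℕₚ.≤-refl) (up-+ a 0 i))
          (linear (trans e (up-+ a 0 i)) (eq₂ a b d (up d i)))
        where
        eq₁ : ∀ a d u v → u - (a + v - d) ≡ u + d - (a + v)
        eq₁ = solve-∀
        eq₂ : ∀ a b d v → b - (a + v + (d + d)) ≡ b - (d + d) - (a + v)
        eq₂ = solve-∀
      end (inj₂ (inj₂ (i , e , _))) =
        Pos-absurd (Pos-up d>0 (d>0 ⊕ d>0) i)
          (trans (up≡ (d + d) i) (linear (sym (trans e (up≡ b i))) (eq b d (+ i))))
        where
        eq : ∀ b d i → d + d + i * d - 0ℤ ≡ b + i * d - (b - (d + d))
        eq = solve-∀

  -- The progressions from d and a end at a − 2d and b − 2d.
  module Interleaved {d a b} (s : Starts d a b) (2~a+d : d + d ~ a + d) (2~b+d : d + d ~ b + d)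
      (k : ℕ) (a≡ : a - (d + d) ≡ Facts.up s d k) (low : ∀ j → j ℕ.≤ k → P (Facts.up s d j))
      (i : ℕ) (b≡ : b - (d + d) ≡ Facts.up s a i) (mid : ∀ j → j ℕ.≤ i → P (Facts.up s a j)) where
    open Facts s

    up-sub : ∀ c {n} j r → n ≡ j ℕ.+ suc r → up c n - up c j ≡ up d r
    up-sub c j r refl = trans (cong (_- up c j) (up-+ c j r)) (eq (up c j) (up d r))
      where eq : ∀ u v → u + v - u ≡ v
            eq = solve-∀

    up-parallel : ∀ n → up a n ≡ up d n + (a - d)
    up-parallel n = trans (cong (λ c → up c n) (eq a d)) (up-translate d (a - d) n)
      where eq : ∀ a d → a ≡ d + (a - d)
            eq = solve-∀

    a≡up : a ≡ up d (suc (suc k))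
    a≡up = linear a≡ (eq a d (up d k))
      where eq : ∀ a d u → a - (u + d + d) ≡ a - (d + d) - u
            eq = solve-∀

    b≡up : b ≡ up a (suc (suc i))
    b≡up = linear b≡ (eq b d (up a i))
      where eq : ∀ a d u → a - (u + d + d) ≡ a - (d + d) - u
            eq = solve-∀

    a-d≡up : a - d ≡ up d (suc k)
    a-d≡up = linear a≡ (eq a d (up d k))
      where eq : ∀ a d u → a - d - (u + d) ≡ a - (d + d) - u
            eq = solve-∀

    b-d≡up : b - d ≡ up a (suc i)
    b-d≡up = linear b≡ (eq b d (up a i))
      where eq : ∀ a d u → a - d - (u + d) ≡ a - (d + d) - u
            eq = solve-∀

    up-suc-k∉ : ¬ P (up d (suc k))
    up-suc-k∉ p = a-d∉ (P-cong p (sym a-d≡up))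

    up-suc-i∉ : ¬ P (up a (suc i))
    up-suc-i∉ p = b-d∉ (P-cong p (sym b-d≡up))

    split : ∀ {m n} → m ℕ.≤ n → suc (suc n) ≡ suc m ℕ.+ suc (n ℕ.∸ m)
    split {m} {n} m≤n = cong suc (sym (trans (ℕₚ.+-suc m (n ℕ.∸ m)) (cong suc (ℕₚ.m+[n∸m]≡n m≤n))))

    -- Each rung is the previous one translated by d. The new candidates a and b drop out: their
    -- distances to `up d (suc j)` are the members `up d (k ∸ j)` and `up a (i ∸ j)` of the first
    -- two progressions.
    ladder : ∀ j → j ℕ.≤ k → j ℕ.≤ suc i → up d j ~ up a j × up d j ~ up b j
    ladder zero _ _ = d~a , d~b
    ladder (suc j) j<k (ℕ.s≤s j≤i) = both (low (suc j) j<k) λ adj → options adj (shift-full (proj₁ rung-j) (proj₂ rung-j) apart adj)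
      where
      rung-j : up d j ~ up a j × up d j ~ up b j
      rung-j = ladder j (ℕₚ.<⇒≤ j<k) (ℕₚ.m≤n⇒m≤1+n j≤i)
      apart : up a j ≢ up b j
      apart e = a≢b (linear (trans (sym (up≡ a j)) (trans e (up≡ b j))) (eq a b d (+ j)))
        where eq : ∀ a b d j → a - b ≡ a + j * d - (b + j * d)
              eq = solve-∀
      a-diff : a - up d (suc j) ≡ up d (k ℕ.∸ j)
      a-diff = trans (cong (_- up d (suc j)) a≡up) (up-sub d (suc j) (k ℕ.∸ j) (split (ℕₚ.<⇒≤ j<k)))
      b-diff : b - up d (suc j) ≡ up a (i ℕ.∸ j)
      b-diff = linear (cong₂ _+_ (trans (cong (_- up a (suc j)) b≡up) (up-sub a (suc j) (i ℕ.∸ j) (split j≤i)))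
                                 (cong₂ _-_ (up-parallel (suc j)) (up-parallel (i ℕ.∸ j))))
                      (eq b (up d (suc j)) (up a (suc j)) (up d (i ℕ.∸ j)) (up a (i ℕ.∸ j)) (a - d))
        where eq : ∀ b u v w x z → b - u - x ≡ b - v + (v - x) - (w + (u + z - (w + z)))
              eq = solve-∀
      options : ∀ {t} → up d (suc j) ~ t → t ≡ a ⊎ t ≡ b ⊎ t ≡ up a j + d ⊎ t ≡ up b j + d →
                t ≡ up a (suc j) ⊎ t ≡ up b (suc j)
      options adj (case₁ refl) = ⊥-elim (difference∈ʳ (low (k ℕ.∸ j) (ℕₚ.m∸n≤m k j)) adj a-diff)
      options adj (case₂ refl) = ⊥-elim (difference∈ʳ (mid (i ℕ.∸ j) (ℕₚ.m∸n≤m i j)) adj b-diff)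
      options adj (case₃ e) = inj₁ e
      options adj (case₄ e) = inj₂ e

    -- Otherwise the ladder would reach `up a (suc i)`, which is b - d.
    k≤i : k ℕ.≤ i
    k≤i = ℕₚ.≮⇒≥ λ i<k → up-suc-i∉ (∈ʳ (proj₁ (ladder (suc i) i<k ℕₚ.≤-refl)))

    b-a≡ : b - a ≡ up d (suc i)
    b-a≡ = trans (cong (_- a) b≡up) (up-sub a 0 (suc i) refl)

    b-a∈ : P (up d (suc i))
    b-a∈ = P-cong (≁⇒∈⁺ a∈ b∈ a≢b (λ adj → triangle-free d~a adj d~b) (d>0 ⊕ Pos-up d>0 d>0 (suc i))
             (linear b-a≡ (eq a b d (up d (suc i))))) b-a≡
      where eq : ∀ a b d u → d - (a - b) - (d + u) ≡ b - a - u
            eq = solve-∀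

    -- For `k = i` the element b - a of S would equal a - d.
    k<i : k ℕ.< i
    k<i = ℕₚ.≤∧≢⇒< k≤i λ { refl → up-suc-k∉ b-a∈ }

    -- Applied when i = 2k + 1: with u = k d, all the elements involved are multiples of d determined
    -- by u.
    no-other-neighbour : ∀ {u} → a ≡ u + d + d + d → b ≡ u + u + u + d + d + d + d + d + d → P u →
             u ~ u + u + d + d → P (u + u + u + d + d + d + d) →
             ∀ {y} → u + u + d + d + d ~ y → y ≡ u + d
    no-other-neighbour {u} a≡ b≡ u∈ u~ T∈ adj = options adj (shift-full (~-sym u~) y₁~T u≢T adj)
      where
      y₁~T : u + u + d + d ~ u + u + u + d + d + d + d
      y₁~T = adj⁺ (∈ʳ u~) T∈ (λ e → <⇒≢ (positive u∈ ⊕ d>0 ⊕ d>0) e (solve (u ∷ d ∷ []))) a-d∉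
               (linear (sym a≡) (solve (u ∷ a ∷ d ∷ []))) (positive u∈ ⊕ d>0 ⊕ d>0 ⊕ d>0) (solve (u ∷ d ∷ []))
      u≢T : u ≢ u + u + u + d + d + d + d
      u≢T e = <⇒≢ (positive u∈ ⊕ positive u∈ ⊕ d>0 ⊕ d>0 ⊕ d>0 ⊕ d>0) e (solve (u ∷ d ∷ []))
      options : ∀ {y} → u + u + d + d + d ~ y →
                y ≡ a ⊎ y ≡ b ⊎ y ≡ u + d ⊎ y ≡ u + u + u + d + d + d + d + d → y ≡ u + d
      options adj (case₁ refl) = ⊥-elim (difference∈ˡ u∈ adj (linear (sym a≡) (solve (u ∷ a ∷ d ∷ []))))
      options adj (case₂ refl) = ⊥-elim (difference∈ʳ a∈ adj (linear (cong₂ _-_ b≡ a≡) (solve (u ∷ a ∷ b ∷ d ∷ []))))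
      options adj (case₃ e) = e
      options adj (case₄ refl) = ⊥-elim (b-d∉ (P-cong (∈ʳ adj) (linear (sym b≡) (solve (u ∷ b ∷ d ∷ [])))))

    -- Since a is itself a multiple of d, its progression resumes the one from d after the single
    -- gap a - d.
    up-beyond : ∀ q → q ℕ.≤ i → P (up d (suc (suc k) ℕ.+ q))
    up-beyond zero _ = P-cong a∈ (trans a≡up (cong (up d) (sym (ℕₚ.+-identityʳ (suc (suc k))))))
    up-beyond (suc q) q<i = P-cong (mid (suc q) q<i)
      (trans (up-+ a 0 q) (trans (cong (_+ up d q) a≡up) (sym (up-+ d (suc (suc k)) q))))

    rung : up d k ~ up a k
    rung = proj₁ (ladder k ℕₚ.≤-refl (ℕₚ.m≤n⇒m≤1+n k≤i))

    -- Translating both edges at `up a k` leaves `up a (suc k)` only the candidates b and y + d, so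
    -- it is joined to b, at distance `up d (i ∸ k)`.
    b-next∉ : ∀ {y} → up a k ~ y → y ≢ up d k → ¬ P (up d (i ℕ.∸ k))
    b-next∉ {y} adj y≢ p = difference∈ʳ p (proj₁ (both (mid (suc k) k<i)
        (λ adj′ → options adj′ (shift-full (~-sym rung) adj (λ e → y≢ (sym e)) adj′))))
        (trans (cong (_- up a (suc k)) b≡up) (up-sub a (suc k) (i ℕ.∸ k) (split k≤i)))
      where
      options : ∀ {t} → up a k + d ~ t → t ≡ a ⊎ t ≡ b ⊎ t ≡ up d k + d ⊎ t ≡ y + d → t ≡ b ⊎ t ≡ y + d
      options adj′ (case₁ refl) = ⊥-elim (difference∈ˡ (low k ℕₚ.≤-refl) adj′ (up-sub a 0 k refl))
      options adj′ (case₂ e) = inj₁ e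
      options adj′ (case₃ refl) = ⊥-elim (up-suc-k∉ (∈ʳ adj′))
      options adj′ (case₄ e) = inj₂ e

    -- Among the indices n up to k + 2 + i, only n = k + 1 has `up d n` missing from S.
    i∸k≡ : ¬ P (up d (i ℕ.∸ k)) → i ℕ.∸ k ≡ suc k
    i∸k≡ ∉ with ℕₚ.<-cmp (i ℕ.∸ k) (suc k)
    ... | tri< (ℕ.s≤s r≤k) _ _ = ⊥-elim (∉ (low (i ℕ.∸ k) r≤k))
    ... | tri≈ _ e _ = e
    ... | tri> _ _ k+1<r = ⊥-elim (∉ (subst (λ n → P (up d n)) (ℕₚ.m+[n∸m]≡n k+1<r)
            (up-beyond (i ℕ.∸ k ℕ.∸ suc (suc k)) (ℕₚ.≤-trans (ℕₚ.m∸n≤m (i ℕ.∸ k) (suc (suc k))) (ℕₚ.m∸n≤m i k)))))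

  interleaved-impossible : ∀ {d a b} (s : Starts d a b) → d + d ~ a + d → d + d ~ b + d →
    (k : ℕ) → a - (d + d) ≡ Facts.up s d k → (∀ j → j ℕ.≤ k → P (Facts.up s d j)) →
    (i : ℕ) → b - (d + d) ≡ Facts.up s a i → (∀ j → j ℕ.≤ i → P (Facts.up s a j)) → ⊥
  -- For k = 0 the missing element a - d would be 2d.
  interleaved-impossible {d} {a} {b} s 2~a+d 2~b+d zero a≡ low i b≡ mid = up-suc-k∉ (∈ˡ 2~a+d)
    where open Interleaved s 2~a+d 2~b+d zero a≡ low i b≡ mid
  interleaved-impossible {d} {a} {b} s 2~a+d 2~b+d (suc k) a≡ low i b≡ mid = contradiction (other (~-sym rung))
    where
    open Facts s
    open Interleaved s 2~a+d 2~b+d (suc k) a≡ low i b≡ mid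
    contradiction : (∃ λ y → up a (suc k) ~ y × y ≢ up d (suc k)) → ⊥
    contradiction (y , adj , y≢) = y≢ (no-other-neighbour {u} a≡up b≡′ (low k (ℕₚ.n≤1+n k))
        (subst (u ~_) A≡ (proj₁ (ladder k (ℕₚ.n≤1+n k) (ℕₚ.m≤n⇒m≤1+n (ℕₚ.<⇒≤ k≤i)))))
        (P-cong (mid i ℕₚ.≤-refl) T≡)
        (subst (_~ y) (cong (_+ d) A≡) adj))
      where
      u : ℤ
      u = up d k
      A≡ : up a k ≡ u + u + d + d
      A≡ = trans (up-parallel k) (trans (cong (λ z → u + (z - d)) a≡up) (eq u d))
        where eq : ∀ u d → u + (u + d + d + d - d) ≡ u + u + d + d
              eq = solve-∀
      i≡ : i ≡ k ℕ.+ suc (suc (suc k))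
      i≡ = trans (sym (ℕₚ.m+[n∸m]≡n k≤i)) (trans (cong (suc k ℕ.+_) (i∸k≡ (b-next∉ adj y≢))) (sym (ℕₚ.+-suc k (suc (suc k)))))
      T≡ : up a i ≡ u + u + u + d + d + d + d
      T≡ = trans (cong (up a) i≡) (trans (up-+ a k (suc (suc k))) (trans (cong (_+ (u + d + d)) A≡) (eq u d)))
        where eq : ∀ u d → u + u + d + d + (u + d + d) ≡ u + u + u + d + d + d + d
              eq = solve-∀
      b≡′ : b ≡ u + u + u + d + d + d + d + d + d
      b≡′ = linear (trans b≡ T≡) (eq u b d)
        where eq : ∀ u b d → b - (u + u + u + d + d + d + d + d + d) ≡ b - (d + d) - (u + u + u + d + d + d + d)
              eq = solve-∀

  -- Both a - 2d and b - 2d are in S and end progressions. Neither ends its own, they cannot end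
  -- each other's, and they cannot both end the one from d; up to exchanging a and b, the
  -- interleaved pattern remains.
  second-a+d-b+d : ∀ {d a b} → Starts d a b → d + d ~ a + d → d + d ~ b + d → ⊥
  second-a+d-b+d {d} {a} {b} s 2~a+d 2~b+d = end (reach a-2d∈) (reach b-2d∈)
    where
    open Facts s
    module S = Facts (swap-starts s)
    2∈ : P (d + d)
    2∈ = ∈ˡ 2~a+d
    a+d≢b+d : a + d ≢ b + d
    a+d≢b+d e = a≢b (linear e (solve (a ∷ b ∷ d ∷ [])))
    2≁a : ¬ d + d ~ a
    2≁a 2~a = degree≤2 2~a+d 2~b+d 2~a a+d≢b+d (λ e → a+d≢a (sym e)) (λ e → S.a+d≢b (sym e))
    2≁b : ¬ d + d ~ b
    2≁b 2~b = degree≤2 2~a+d 2~b+d 2~b a+d≢b+d (λ e → a+d≢b (sym e)) (λ e → S.a+d≢a (sym e))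
    a-2d∈ : P (a - (d + d))
    a-2d∈ = ≁⇒∈⁺ 2∈ a∈ (λ e → a≢2d 2∈ (sym e)) 2≁a a-d>0 (solve (a ∷ d ∷ []))
    b-2d∈ : P (b - (d + d))
    b-2d∈ = ≁⇒∈⁺ 2∈ b∈ (λ e → S.a≢2d 2∈ (sym e)) 2≁b b-d>0 (solve (b ∷ d ∷ []))

    gap>0 : ∀ i → Pos (up (d + d) i)
    gap>0 = Pos-up d>0 (d>0 ⊕ d>0)
    gap : ∀ c {e} i → c - (d + d) ≡ up e i → up (d + d) i ≡ c - e
    gap c {e} i q = trans (up≡ (d + d) i) (linear (sym (trans q (up≡ e i))) (eq c d e (+ i)))
      where eq : ∀ c d e i → d + d + i * d - (c - e) ≡ e + i * d - (c - (d + d))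
            eq = solve-∀

    no-self : ∀ {c t} → Reach c t → t ≢ c - (d + d)
    no-self {c} (i , e , _) f = Pos-absurd (gap>0 i) (trans (gap c i (trans (sym f) e)) (ℤₚ.+-inverseʳ c))

    ended : ∀ c i → c - (d + d) ≡ up d i → up d (suc i) ≡ c - d
    ended c i q = linear (sym q) (eq c d (up d i))
      where eq : ∀ c d u → u + d - (c - d) ≡ u - (c - (d + d))
            eq = solve-∀

    end : Reach d (a - (d + d)) ⊎ Reach a (a - (d + d)) ⊎ Reach b (a - (d + d)) →
          Reach d (b - (d + d)) ⊎ Reach a (b - (d + d)) ⊎ Reach b (b - (d + d)) → ⊥
    end (inj₂ (inj₁ r)) _ = no-self r refl
    end _ (inj₂ (inj₂ r)) = no-self r refl
    end (inj₁ (k , e , low)) (inj₂ (inj₁ (i , f , mid))) = interleaved-impossible s 2~a+d 2~b+d k e low i f mid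
    end (inj₂ (inj₂ (i , f , mid))) (inj₁ (k , e , low)) =
      interleaved-impossible (swap-starts s) 2~b+d 2~a+d k e low i f mid
    end (inj₂ (inj₂ (i , e , _))) (inj₂ (inj₁ (j , f , _))) =
      Pos-absurd (gap>0 i ⊕ gap>0 j) (trans (cong₂ _+_ (gap a i e) (gap b j f)) (solve (a ∷ b ∷ [])))
    end (inj₁ (i , e , low)) (inj₁ (j , f , low′)) = compare (ℕₚ.<-cmp i j)
      where
      compare : _ → ⊥
      compare (tri< i<j _ _) = a-d∉ (P-cong (low′ (suc i) i<j) (ended a i e))
      compare (tri≈ _ refl _) = a≢b (linear (trans e (sym f)) (solve (a ∷ b ∷ d ∷ [])))
      compare (tri> _ _ j<i) = b-d∉ (P-cong (low (suc j) j<i) (ended b j f))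

  -- Positive signatures without 2d

  module _ {d a} (s : Starts d a (d + d + d)) where
    open Facts s

    a≢4d : a ≢ d + d + d + d
    a≢4d e = a-d∉ (P-cong b∈ (linear (sym e) (solve (a ∷ d ∷ []))))

    -- Because a > d, the element 3d - a is below 2d and has no predecessor, so it is one of the
    -- starts.
    3d-a≡a : P (d + d + d - a) → d + d + d - a ≡ a
    3d-a≡a p = start (descend p)
      where
      start : d + d + d - a ≡ d ⊎ d + d + d - a ≡ a ⊎ d + d + d - a ≡ d + d + d ⊎ P (d + d + d - a - d) →
              d + d + d - a ≡ a
      start (case₁ e) = ⊥-elim (a-d∉ (P-cong d∈ (linear e (solve (a ∷ d ∷ [])))))
      start (case₂ e) = e
      start (case₃ e) = ⊥-elim (<⇒≢ (positive a∈) e (solve (a ∷ d ∷ [])))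
      start (case₄ p) = ⊥-elim (below p a-d>0 (solve (a ∷ d ∷ [])))

    2d-a∉ : ¬ P (d + d - a)
    2d-a∉ q = below q a-d>0 (solve (a ∷ d ∷ []))

    3d~a+d : d + d + d - a ≡ a → P (a + d) → d + d + d ~ a + d
    3d~a+d e p = ~-sym (adj⁺ p b∈ (λ f → a-d∉ (P-cong d∈ (linear (sym f) (solve (a ∷ d ∷ [])))))
      2d-a∉ (solve (a ∷ d ∷ [])) (positive a∈) (e after solve (a ∷ d ∷ [])))

  -- As neighbours of d, the elements 3d and b are not joined, so one of their differences is in S.
  -- Either b is 3d/2 and acquires the neighbours d, 4d and 5d, or b - 3d is in S, and 4d being
  -- joined to b leaves it no predecessor.
  starts-at-3d : ∀ {d a b} → Starts d a b → a ≡ d + d + d → ¬ P (d + d) →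
                 P (a + d) → P (a + d + d) → P (a + d + d + d) → ⊥
  starts-at-3d {d} {_} {b} s refl 2∉ 4∈ 5∈ 6∈ =
    [ beyond , (λ p → half (3d-a≡a s′ p)) ] (≁⇒∈ b∈ a∈ (λ e → a≢b (sym e)) (λ adj → triangle-free d~b adj d~a))
    where
    s′ : Starts d b (d + d + d)
    s′ = swap-starts s
    open Facts s
    3~5 : d + d + d ~ d + d + d + d + d
    3~5 = adj⁺ a∈ 5∈ (λ e → <⇒≢ (d>0 ⊕ d>0) e (solve (d ∷ []))) 2∉ (solve (d ∷ []))
            (d>0 ⊕ d>0 ⊕ d>0) (solve (d ∷ []))
    d≢5d : d ≢ d + d + d + d + d
    d≢5d e = <⇒≢ (d>0 ⊕ d>0 ⊕ d>0 ⊕ d>0) e (solve (d ∷ []))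
    b≢5d : b ≢ d + d + d + d + d
    b≢5d e = b-d∉ (P-cong 4∈ (linear (sym e) (solve (b ∷ d ∷ []))))

    half : d + d + d - b ≡ b → ⊥
    half e = degree≤2 b~d b~4 b~5 (λ f → <⇒≢ (d>0 ⊕ d>0 ⊕ d>0) f (solve (d ∷ [])))
               (λ f → d≢5d (sym f)) (λ f → >⇒≢ d>0 f (solve (d ∷ [])))
      where
      b+d∉ : ¬ P (b + d)
      b+d∉ p = degree≤2 a~d 3~5 (3d~a+d s′ e p) d≢5d (λ f → >⇒≢ (positive b∈) f (solve (b ∷ d ∷ [])))
                 (λ f → a≢4d s′ (linear f (solve (b ∷ d ∷ []))))
      b+2d∉ : ¬ P (b + d + d)
      b+2d∉ p = start (descend p)
        where
        start : b + d + d ≡ d ⊎ b + d + d ≡ d + d + d ⊎ b + d + d ≡ b ⊎ P (b + d + d - d) → ⊥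
        start (case₁ f) = >⇒≢ (positive b∈ ⊕ d>0) f (solve (b ∷ d ∷ []))
        start (case₂ f) = >⇒≢ b-d>0 f (solve (b ∷ d ∷ []))
        start (case₃ f) = >⇒≢ (d>0 ⊕ d>0) f (solve (b ∷ d ∷ []))
        start (case₄ q) = b+d∉ (P-cong q (solve (b ∷ d ∷ [])))
      b~4 : b ~ d + d + d + d
      b~4 = adj⁺ b∈ 4∈ (a≢4d s′) b+d∉ (linear e (solve (b ∷ d ∷ [])))
              (positive b∈ ⊕ d>0 ⊕ d>0) (linear e (solve (b ∷ d ∷ [])))
      b~5 : b ~ d + d + d + d + d
      b~5 = adj⁺ b∈ 5∈ b≢5d b+2d∉ (linear e (solve (b ∷ d ∷ [])))
              (positive b∈ ⊕ d>0 ⊕ d>0 ⊕ d>0) (linear e (solve (b ∷ d ∷ [])))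

    beyond : P (b - (d + d + d)) → ⊥
    beyond p = start (descend p)
      where
      options : ∀ {t} → d + d + d + d ~ t →
        t ≡ d + d + d ⊎ t ≡ b ⊎ t ≡ d + d ⊎ t ≡ d + d + d + d + d + d → t ≡ b ⊎ t ≡ d + d + d + d + d + d
      options adj (case₁ refl) = ⊥-elim (difference∈ˡ d∈ adj (solve (d ∷ [])))
      options adj (case₂ e) = inj₁ e
      options adj (case₃ refl) = ⊥-elim (2∉ (∈ʳ adj))
      options adj (case₄ e) = inj₂ e
      4~b : d + d + d + d ~ b
      4~b = proj₁ (both 4∈ (λ adj → options adj (shift-full a~d 3~5 d≢5d adj)))
      start : b - (d + d + d) ≡ d ⊎ b - (d + d + d) ≡ d + d + d ⊎ b - (d + d + d) ≡ b ⊎ P (b - (d + d + d) - d) → ⊥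
      start (case₁ e) = b-d∉ (P-cong a∈ (linear (sym e) (solve (b ∷ d ∷ []))))
      start (case₂ e) = b-d∉ (P-cong 5∈ (linear (sym e) (solve (b ∷ d ∷ []))))
      start (case₃ e) = <⇒≢ (d>0 ⊕ d>0 ⊕ d>0) e (solve (b ∷ d ∷ []))
      start (case₄ q) = difference∈ʳ q 4~b (solve (b ∷ d ∷ []))

  -- The hard case is a - 3d in S. Then 3d is joined to d and a + d, which excludes 5d, so the
  -- progression from 3d holds at most 3d and 4d. As a - 3d must lie there, a is 6d or 7d.
  other-starts-at-3d : ∀ {d a b} → Starts d a b → b ≡ d + d + d → ¬ P (d + d) →
                       P (a + d) → P (a + d + d) → P (a + d + d + d) → ⊥
  other-starts-at-3d {d} {a} {_} s refl 2∉ a+1∈ a+2∈ a+3∈ =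
    [ beyond , (λ p → half (3d-a≡a s p)) ] (≁⇒∈ a∈ b∈ a≢b (λ adj → triangle-free d~a adj d~b))
    where
    open Facts s
    module S = Facts (swap-starts s)

    d≢a+d : d ≢ a + d
    d≢a+d e = <⇒≢ (positive a∈) e (solve (a ∷ d ∷ []))
    d≢a+2d : d ≢ a + d + d
    d≢a+2d e = <⇒≢ (positive a∈ ⊕ d>0) e (solve (a ∷ d ∷ []))
    a~a+2d : a ~ a + d + d
    a~a+2d = adj⁺ a∈ a+2∈ (λ e → <⇒≢ (d>0 ⊕ d>0) e (solve (a ∷ d ∷ []))) 2∉ (solve (a ∷ d ∷ []))
               (d>0 ⊕ d>0 ⊕ d>0) (solve (a ∷ d ∷ []))

    half : d + d + d - a ≡ a → ⊥
    half e = degree≤2 b~d (3d~a+d s e a+1∈) 3d~a+2d d≢a+d (λ f → d≢a+2d (sym f))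
               (λ f → >⇒≢ d>0 f (solve (a ∷ d ∷ [])))
      where
      3d~a+2d : d + d + d ~ a + d + d
      3d~a+2d = adj⁺ b∈ a+2∈ (λ f → <⇒≢ a-d>0 f (solve (a ∷ d ∷ []))) a-d∉ (solve (a ∷ d ∷ []))
                  (positive a∈) (solve (a ∷ d ∷ []))

    options : ∀ {t} → a + d ~ t → t ≡ a ⊎ t ≡ d + d + d ⊎ t ≡ d + d ⊎ t ≡ a + d + d + d →
              t ≡ d + d + d ⊎ t ≡ a + d + d + d
    options adj (case₁ refl) = ⊥-elim (difference∈ˡ d∈ adj (solve (a ∷ d ∷ [])))
    options adj (case₂ e) = inj₁ e
    options adj (case₃ refl) = ⊥-elim (2∉ (∈ʳ adj))
    options adj (case₄ e) = inj₂ e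
    a+d~3d : a + d ~ d + d + d
    a+d~3d = proj₁ (both a+1∈ (λ adj → options adj (shift-full a~d a~a+2d d≢a+2d adj)))

    a≡6d : a - (d + d + d) ≡ d + d + d → ⊥
    a≡6d e = 4∉ (P-cong (≁⇒∈⁺ a∈ a+4∈ (λ f → <⇒≢ (d>0 ⊕ d>0 ⊕ d>0 ⊕ d>0) f (solve (a ∷ d ∷ []))) a≁a+4d
               (d>0 ⊕ d>0 ⊕ d>0 ⊕ d>0 ⊕ d>0) (solve (a ∷ d ∷ []))) (solve (a ∷ d ∷ [])))
      where
      4∉ : ¬ P (d + d + d + d)
      4∉ p = difference∈ˡ p a+d~3d (linear e (solve (a ∷ d ∷ [])))
      a+4∈ : P (a + d + d + d + d)
      -- With 2d and 4d missing, only d and 3d lie outside the progression from a.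
      a+4∈ = S.long-enough 1 1 4 (ℕₚ.m≤m+n 7 1) 2∉ 4∉
      a≁a+4d : ¬ a ~ a + d + d + d + d
      a≁a+4d adj = degree≤2 a~d a~a+2d adj d≢a+2d
        (λ f → >⇒≢ (positive a∈ ⊕ d>0 ⊕ d>0 ⊕ d>0) f (solve (a ∷ d ∷ [])))
        (λ f → >⇒≢ (d>0 ⊕ d>0) f (solve (a ∷ d ∷ [])))

    a≡7d : P (d + d + d + d) → a - (d + d + d) ≡ d + d + d + d → ⊥
    a≡7d 4∈ e = degree≥2 4∈ (λ adj → options′ adj (shift-full b~d (~-sym a+d~3d) d≢a+d adj))
      where
      options′ : ∀ {t} → d + d + d + d ~ t → t ≡ a ⊎ t ≡ d + d + d ⊎ t ≡ d + d ⊎ t ≡ a + d + d → t ≡ a + d + d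
      options′ adj (case₁ refl) = ⊥-elim (difference∈ʳ b∈ adj (linear e (solve (a ∷ d ∷ []))))
      options′ adj (case₂ refl) = ⊥-elim (difference∈ˡ d∈ adj (solve (d ∷ [])))
      options′ adj (case₃ refl) = ⊥-elim (2∉ (∈ʳ adj))
      options′ adj (case₄ f) = f

    beyond : P (a - (d + d + d)) → ⊥
    beyond p = end (reach p)
      where
      5∉ : ¬ P (d + d + d + d + d)
      5∉ 5∈ = degree≤2 b~d (~-sym a+d~3d) 3~5 d≢a+d
                (λ f → >⇒≢ (d>0 ⊕ d>0 ⊕ d>0 ⊕ d>0) f (solve (d ∷ [])))
                (λ f → a≢4d s (linear (sym f) (solve (a ∷ d ∷ []))))
        where
        3~5 : d + d + d ~ d + d + d + d + d
        3~5 = adj⁺ b∈ 5∈ (λ f → <⇒≢ (d>0 ⊕ d>0) f (solve (d ∷ []))) 2∉ (solve (d ∷ []))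
                (d>0 ⊕ d>0 ⊕ d>0) (solve (d ∷ []))
      end : Reach d (a - (d + d + d)) ⊎ Reach a (a - (d + d + d)) ⊎ Reach (d + d + d) (a - (d + d + d)) → ⊥
      end (inj₁ (zero , e , _)) = a≢4d s (linear {a - (d + d + d)} {d} e (solve (a ∷ d ∷ [])))
      end (inj₁ (suc i , _ , low)) = 2∉ (low 1 (ℕ.s≤s ℕ.z≤n))
      end (inj₂ (inj₁ (i , e , _))) = Pos-absurd (Pos-up d>0 (d>0 ⊕ d>0 ⊕ d>0) i)
        (trans (up≡ (d + d + d) i) (linear (sym (trans e (up≡ a i))) (eq a d (+ i))))
        where eq : ∀ a d i → d + d + d + i * d - 0ℤ ≡ a + i * d - (a - (d + d + d))
              eq = solve-∀
      end (inj₂ (inj₂ (zero , e , _))) = a≡6d e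
      end (inj₂ (inj₂ (suc zero , e , low))) = a≡7d (low 1 ℕₚ.≤-refl) e
      end (inj₂ (inj₂ (suc (suc i) , _ , low))) = 5∉ (low 2 (ℕ.s≤s (ℕ.s≤s ℕ.z≤n)))

  -- The missing 2d joins a to a + 2d, so a + 3d is not joined to a and 3d is in S. It has no
  -- predecessor, hence it is a or b.
  no-second : ∀ {d a b} → Starts d a b → ¬ P (d + d) → P (a + d) → P (a + d + d) → P (a + d + d + d) → ⊥
  no-second {d} {a} {b} s 2∉ a+1∈ a+2∈ a+3∈ = start (descend 3∈)
    where
    open Facts s
    a~a+2d : a ~ a + d + d
    a~a+2d = adj⁺ a∈ a+2∈ (λ e → <⇒≢ (d>0 ⊕ d>0) e (solve (a ∷ d ∷ []))) 2∉ (solve (a ∷ d ∷ []))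
               (d>0 ⊕ d>0 ⊕ d>0) (solve (a ∷ d ∷ []))
    a≁a+3d : ¬ a ~ a + d + d + d
    a≁a+3d adj = degree≤2 a~d a~a+2d adj (λ f → <⇒≢ (positive a∈ ⊕ d>0) f (solve (a ∷ d ∷ [])))
        (λ f → >⇒≢ (positive a∈ ⊕ d>0 ⊕ d>0) f (solve (a ∷ d ∷ [])))
        (λ f → >⇒≢ d>0 f (solve (a ∷ d ∷ [])))
    3∈ : P (d + d + d)
    3∈ = P-cong (≁⇒∈⁺ a∈ a+3∈ (λ f → <⇒≢ (d>0 ⊕ d>0 ⊕ d>0) f (solve (a ∷ d ∷ []))) a≁a+3d
               (d>0 ⊕ d>0 ⊕ d>0 ⊕ d>0) (solve (a ∷ d ∷ []))) (solve (a ∷ d ∷ []))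
    start : d + d + d ≡ d ⊎ d + d + d ≡ a ⊎ d + d + d ≡ b ⊎ P (d + d + d - d) → ⊥
    start (case₁ e) = 3d≢d e
    start (case₂ e) = starts-at-3d s (sym e) 2∉ a+1∈ a+2∈ a+3∈
    start (case₃ e) = other-starts-at-3d s (sym e) 2∉ a+1∈ a+2∈ a+3∈
    start (case₄ p) = 2∉ (P-cong p (solve (d ∷ [])))

  positive-impossible : ⊥
  positive-impossible with minimum
  ... | d , d∈ , least with degree d∈
  ... | a , b , d~a , d~b , a≢b , _ = second (P? (d + d))
    where
    s s′ : Starts _ _ _
    s = record { d-least = least ; d~a = d~a ; d~b = d~b ; a≢b = a≢b }
    s′ = swap-starts s
    open Facts s
    second : Dec (P (d + d)) → ⊥
    second (yes 2∈) with degree 2∈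
    ... | t , u , 2~t , 2~u , t≢u , _ = cases 2~t 2~u t≢u (two-neighbours 2∈ 2~t) (two-neighbours 2∈ 2~u)
      where
      cases : ∀ {t u} → d + d ~ t → d + d ~ u → t ≢ u → t ≡ a ⊎ t ≡ b ⊎ t ≡ a + d ⊎ t ≡ b + d →
              u ≡ a ⊎ u ≡ b ⊎ u ≡ a + d ⊎ u ≡ b + d → ⊥
      cases p q n (case₁ refl) (case₁ refl) = n refl
      cases p q n (case₁ refl) (case₂ refl) = second-a-b s p q
      cases p q n (case₁ refl) (case₃ refl) = second-a-a+d s p q
      cases p q n (case₁ refl) (case₄ refl) = second-a-b+d s p q
      cases p q n (case₂ refl) (case₁ refl) = second-a-b s q p
      cases p q n (case₂ refl) (case₂ refl) = n refl
      cases p q n (case₂ refl) (case₃ refl) = second-a-b+d s′ p q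
      cases p q n (case₂ refl) (case₄ refl) = second-a-a+d s′ p q
      cases p q n (case₃ refl) (case₁ refl) = second-a-a+d s q p
      cases p q n (case₃ refl) (case₂ refl) = second-a-b+d s′ q p
      cases p q n (case₃ refl) (case₃ refl) = n refl
      cases p q n (case₃ refl) (case₄ refl) = second-a+d-b+d s p q
      cases p q n (case₄ refl) (case₁ refl) = second-a-b+d s q p
      cases p q n (case₄ refl) (case₂ refl) = second-a-a+d s′ q p
      cases p q n (case₄ refl) (case₃ refl) = second-a+d-b+d s q p
      cases p q n (case₄ refl) (case₄ refl) = n refl
    second (no 2∉) = cases (P? (a + d)) (P? (a + d + d)) (P? (a + d + d + d))
      where
      -- One element over d and at most three over a leave at least four over b.
      long-b : ∀ j → j ℕ.≤ 3 → ¬ P (up a j) → ⊥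
      long-b j j≤3 ∉ = no-second s′ 2∉ (chain 1 (ℕₚ.m≤m+n 1 2)) (chain 2 (ℕₚ.m≤m+n 2 1)) (chain 3 ℕₚ.≤-refl)
        where
        chain : ∀ n → n ℕ.≤ 3 → P (up b n)
        chain n n≤3 = long-enough 1 j n (ℕ.s≤s (ℕ.s≤s (ℕₚ.+-mono-≤ j≤3 n≤3))) 2∉ ∉
      cases : Dec (P (a + d)) → Dec (P (a + d + d)) → Dec (P (a + d + d + d)) → ⊥
      cases (no ∉) _ _ = long-b 1 (ℕₚ.m≤m+n 1 2) ∉
      cases _ (no ∉) _ = long-b 2 (ℕₚ.m≤m+n 2 1) ∉
      cases _ _ (no ∉) = long-b 3 ℕₚ.≤-refl ∉
      cases (yes p) (yes q) (yes r) = no-second s 2∉ p q r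

-- Signatures with a negative element

module Refutation (C : Config) where
  open Graph C

  module Top {M : ℤ} (M∈ : P M) (M-greatest : ∀ {t} → P t → t ≡ M ⊎ Pos (M - t)) where

    above : ∀ {t w} → P t → Pos w → t - M ≢ w
    above {t} p w>0 e with M-greatest p
    ... | inj₁ refl = >⇒≢ w>0 (refl {x = t}) e
    ... | inj₂ q = Pos-absurd (q ⊕ w>0) (trans (cong (λ w → M - t + w) (sym e)) (solve (t ∷ M ∷ [])))

    -- With M negative, S would have no positive element at all, and M would be joined to
    -- everything.
    M>0 : Pos M
    M>0 = go (sign M)
      where
      go : Pos M ⊎ M ≡ 0ℤ ⊎ Pos (- M) → Pos M
      go (inj₁ p) = p
      go (inj₂ (inj₁ refl)) = ⊥-elim (0∉ M∈)
      go (inj₂ (inj₂ M<0)) with degree M∈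
      ... | y , z , _ , _ , _ , only with fresh (M ∷ y ∷ z ∷ []) (ℕₚ.m≤m+n 4 4)
      ... | t , t∈ , t∉ = ⊥-elim ([ (λ e → t∉ (there (here e))) , (λ e → t∉ (there (there (here e)))) ] (only
              (mk~ M∈ t∈ (λ e → t∉ (here (sym e))) ¬Q ¬Q)))
        where
        ¬Q : ∀ {t} → ¬ Q t
        ¬Q {t} (mkQ p q) = above q (p ⊕ M<0) refl

    negative~M : ∀ {n} → P n → Pos (- n) → n ~ M
    negative~M {n} n∈ n<0 = mk~ n∈ M∈ (λ e → <⇒≢ (M>0 ⊕ n<0) e refl)
      (λ (mkQ p _) → Pos-absurd (p ⊕ M>0 ⊕ n<0) (solve (n ∷ M ∷ [])))
      (λ (mkQ _ q) → above q n<0 (solve (n ∷ M ∷ [])))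

    -- The elements t + x, for t positive, are exactly the distances to −x; only M and one further
    -- element u fail to have such a distance in S.
    module Translate {x : ℤ} (x>0 : Pos x) (-x~M : - x ~ M) where
      u : ℤ
      u = proj₁ (other -x~M)
      -x~u : - x ~ u
      -x~u = proj₁ (proj₂ (other -x~M))
      u≢M : u ≢ M
      u≢M = proj₂ (proj₂ (other -x~M))

      only : ∀ {t} → - x ~ t → t ≡ M ⊎ t ≡ u
      only = full -x~M -x~u (λ e → u≢M (sym e))

      translate : ∀ {t} → Q t → t ≢ M → t ≢ u → Q (t + x)
      translate {t} (mkQ t>0 t∈) t≢M t≢u = go (≁⇒Q (∈ˡ -x~M) t∈ (λ e → >⇒≢ (t>0 ⊕ x>0) (sym e) (solve (t ∷ x ∷ [])))
                                    (λ adj → [ t≢M , t≢u ] (only adj)))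
        where
        go : Q (- x - t) ⊎ Q (t - - x) → Q (t + x)
        go (inj₁ (mkQ p _)) = ⊥-elim (Pos-absurd (p ⊕ x>0 ⊕ t>0) (solve (t ∷ x ∷ [])))
        go (inj₂ q) = Q-cong q (solve (t ∷ x ∷ []))

      module _ (x∉ : ¬ P x) where
        t~t+x : ∀ {t} → P t → P (t + x) → t ~ t + x
        t~t+x {t} p q = mk~ p q (λ e → <⇒≢ x>0 e (solve (t ∷ x ∷ [])))
          (λ (mkQ r _) → Pos-absurd (r ⊕ x>0) (solve (t ∷ x ∷ [])))
          (λ (mkQ _ r) → x∉ (P-cong r (solve (t ∷ x ∷ []))))

        -- Repeatedly adding x is a walk in H that can stop only at M or u, and these two are both
        -- joined to -x.
        connected-fuel : ∀ n {t} → Q t → Pos (+ n - (M - t)) → side t ≡ side M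
        connected-fuel zero {t} q r = ⊥-elim (above (is-in q) r (solve (M ∷ t ∷ [])))
        connected-fuel (suc n) {t} q r = go (t ℤₚ.≟ M) (t ℤₚ.≟ u)
          where
          go : Dec (t ≡ M) → Dec (t ≡ u) → side t ≡ side M
          go (yes refl) _ = refl
          go _ (yes refl) = trans (sym (side-~ -x~u)) (side-~ -x~M)
          go (no t≢M) (no t≢u) = trans (side-~ (t~t+x (is-in q) (is-in (translate q t≢M t≢u))))
            (connected-fuel n (translate q t≢M t≢u) (Pos-cong (Pos-pred r x>0) (eq (+ n) M t x)))
            where eq : ∀ n M t x → 1ℤ + n - (M - t) + x - 1ℤ ≡ n - (M - (t + x))
                  eq = solve-∀

        connected : ∀ {t} → Q t → side t ≡ side M
        connected {t} q with M-greatest (is-in q)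
        ... | inj₁ refl = refl
        ... | inj₂ p with M - t in e
        ... | + n = connected-fuel (suc n) q
              (Pos-cong (+<+ (ℕ.s≤s (ℕ.z≤n {0}))) (trans (eq (+ n)) (cong (λ z → 1ℤ + + n - z) (sym e))))
          where eq : ∀ n → 1ℤ ≡ 1ℤ + n - n
                eq = solve-∀

      disconnected : (∀ {t} → P t → t ~ M ⊎ Pos t) → P x
      disconnected cover with P? x
      ... | yes p = p
      ... | no x∉ with side-mixed
      ... | s , t , s∈ , t∈ , s≢t = ⊥-elim (s≢t (trans (to-M s∈) (sym (to-M t∈))))
        where
        to-M : ∀ {t} → P t → side t ≡ side M
        to-M t∈ with cover t∈
        ... | inj₁ adj = side-~ adj
        ... | inj₂ t>0 = connected x∉ (mkQ t>0 t∈)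

    -- Two negative elements

    module TwoNegatives {x y : ℤ} (y>0 : Pos y) (y<x : Pos (x - y)) (M~-x : M ~ - x) (M~-y : M ~ - y)
                        (negative : ∀ {t} → P t → t ≡ - x ⊎ t ≡ - y ⊎ Pos t) where
      x>0 : Pos x
      x>0 = Pos-cong (y<x ⊕ y>0) (solve (x ∷ y ∷ []))

      module X = Translate x>0 (~-sym M~-x)
      module Y = Translate y>0 (~-sym M~-y)

      cover : ∀ {t} → P t → t ~ M ⊎ Pos t
      cover t∈ with negative t∈
      ... | case₁ refl = inj₁ (~-sym M~-x)
      ... | case₂ refl = inj₁ (~-sym M~-y)
      ... | inj₂ (inj₂ t>0) = inj₂ t>0

      x∈ : P x
      x∈ = X.disconnected cover
      y∈ : P y
      y∈ = Y.disconnected cover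

      -x≢-y : - x ≢ - y
      -x≢-y e = <⇒≢ y<x e (solve (x ∷ y ∷ []))

      positive≁M : ∀ {t} → Pos t → M ~ t → ⊥
      positive≁M {t} t>0 adj = go (full M~-x M~-y -x≢-y adj)
        where
        go : t ≡ - x ⊎ t ≡ - y → ⊥
        go (inj₁ e) = >⇒≢ (t>0 ⊕ x>0) e (solve (t ∷ x ∷ []))
        go (inj₂ e) = >⇒≢ (t>0 ⊕ y>0) e (solve (t ∷ y ∷ []))

      reflect : ∀ {t} → Q t → t ≢ M → Q (M - t)
      reflect {t} (mkQ t>0 t∈) t≢M = go (≁⇒Q M∈ t∈ (λ e → t≢M (sym e)) (positive≁M t>0))
        where
        go : Q (M - t) ⊎ Q (t - M) → Q (M - t)
        go (inj₁ q) = q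
        go (inj₂ (mkQ p _)) = ⊥-elim (above t∈ p refl)

      module Neighbours {w : ℤ} (w>0 : Pos w) (w∈ : P w) (-w~M : - w ~ M) where
        open Translate w>0 -w~M

        -- For a positive neighbour t of w, reflecting, adding w and reflecting again would produce
        -- M - t, M - t + w and t - w. The last is not in S, so the translation fails, which forces
        -- M - t = u.
        neighbours : ∀ {t} → w ~ t → t ≡ - x ⊎ t ≡ - y ⊎ t ≡ M - u
        neighbours {t} adj = go (negative (∈ʳ adj))
          where
          go : t ≡ - x ⊎ t ≡ - y ⊎ Pos t → t ≡ - x ⊎ t ≡ - y ⊎ t ≡ M - u
          go (case₁ e) = case₁ e
          go (case₂ e) = case₂ e
          go (inj₂ (inj₂ t>0)) = inj₂ (inj₂ (shifted (reflect (mkQ t>0 (∈ʳ adj)) t≢M)))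
            where
            t≢M : t ≢ M
            t≢M refl = positive≁M w>0 (~-sym adj)
            shifted : Q (M - t) → t ≡ M - u
            shifted q = check ((M - t) ℤₚ.≟ u)
              where
              check : Dec (M - t ≡ u) → t ≡ M - u
              check (yes e) = linear (sym e) (eq M t u)
                where eq : ∀ M t u → t - (M - u) ≡ u - (M - t)
                      eq = solve-∀
              check (no s≢u) = ⊥-elim (∉ʳ adj (Q-cong (reflect
                  (translate q (λ e → <⇒≢ t>0 e (solve (M ∷ t ∷ []))) s≢u)
                  (λ e → distinct adj (linear e (solve (M ∷ t ∷ w ∷ [])))))
                (solve (M ∷ t ∷ w ∷ []))))

      module NX = Neighbours x>0 x∈ (~-sym M~-x)
      module NY = Neighbours y>0 y∈ (~-sym M~-y)

      y≢M : y ≢ M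
      y≢M refl = above x∈ y<x refl

      x-y∈ : Q (x - y)
      x-y∈ = go (≁⇒Q (∈ʳ M~-x) (∈ʳ M~-y) -x≢-y (λ adj → triangle-free M~-x adj M~-y))
        where
        go : Q (- x - - y) ⊎ Q (- y - - x) → Q (x - y)
        go (inj₁ (mkQ p _)) = ⊥-elim (Pos-absurd (p ⊕ y<x) (solve (x ∷ y ∷ [])))
        go (inj₂ q) = Q-cong q (solve (x ∷ y ∷ []))

      -- If x = M, adding x to a positive element leaves S, so u is the only positive element
      -- besides x. Then y = x - y = u, and y can be joined only to -x.
      x≢M : x ≢ M
      x≢M refl = degree≥2 y∈ (λ {t} adj → options adj (negative (∈ʳ adj)))
        where
        only-u : ∀ {t} → Q t → t ≢ x → t ≡ X.u
        only-u {t} q t≢x with t ℤₚ.≟ X.u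
        ... | yes e = e
        ... | no t≢u = ⊥-elim (above (is-in (X.translate q t≢x t≢u)) (is-pos q) (solve (t ∷ x ∷ [])))
        y≡u : y ≡ X.u
        y≡u = only-u (mkQ y>0 y∈) y≢M
        x-y≡u : x - y ≡ X.u
        x-y≡u = only-u x-y∈ (λ e → <⇒≢ y>0 e (solve (x ∷ y ∷ [])))
        options : ∀ {t} → y ~ t → t ≡ - x ⊎ t ≡ - y ⊎ Pos t → t ≡ - x
        options adj (case₁ e) = e
        options adj (case₂ refl) = ⊥-elim (∉ˡ adj (Q-cong (mkQ x>0 x∈)
          (linear (trans x-y≡u (sym y≡u)) (solve (x ∷ y ∷ [])))))
        options adj (inj₂ (inj₂ t>0)) = ⊥-elim (distinct adj (trans y≡u (sym (only-u (mkQ t>0 (∈ʳ adj))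
          (λ { refl → ∉ʳ adj x-y∈ })))))

      -- Apart from -x and -y only one candidate is available to y, so y is joined to one of these
      -- two and is its neighbour other than M.
      y≡ : y ≡ X.u ⊎ y ≡ Y.u
      y≡ with degree y∈
      ... | s , t , y~s , y~t , s≢t , _ = go y~s y~t s≢t (NY.neighbours y~s) (NY.neighbours y~t)
        where
        from-x : y ~ - x → y ≡ X.u ⊎ y ≡ Y.u
        from-x adj = inj₁ ([ (λ e → ⊥-elim (y≢M e)) , (λ e → e) ] (X.only (~-sym adj)))
        from-y : y ~ - y → y ≡ X.u ⊎ y ≡ Y.u
        from-y adj = inj₂ ([ (λ e → ⊥-elim (y≢M e)) , (λ e → e) ] (Y.only (~-sym adj)))
        go : ∀ {s t} → y ~ s → y ~ t → s ≢ t → s ≡ - x ⊎ s ≡ - y ⊎ s ≡ M - Y.u →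
             t ≡ - x ⊎ t ≡ - y ⊎ t ≡ M - Y.u → y ≡ X.u ⊎ y ≡ Y.u
        go p _ _ (case₁ refl) _ = from-x p
        go p _ _ (case₂ refl) _ = from-y p
        go _ q _ _ (case₁ refl) = from-x q
        go _ q _ _ (case₂ refl) = from-y q
        go _ _ n (inj₂ (inj₂ refl)) (inj₂ (inj₂ refl)) = ⊥-elim (n refl)

      x≡ : x ≡ X.u ⊎ x ≡ Y.u
      x≡ with degree x∈
      ... | s , t , x~s , x~t , s≢t , _ = go x~s x~t s≢t (NX.neighbours x~s) (NX.neighbours x~t)
        where
        from-x : x ~ - x → x ≡ X.u ⊎ x ≡ Y.u
        from-x adj = inj₁ ([ (λ e → ⊥-elim (x≢M e)) , (λ e → e) ] (X.only (~-sym adj)))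
        from-y : x ~ - y → x ≡ X.u ⊎ x ≡ Y.u
        from-y adj = inj₂ ([ (λ e → ⊥-elim (x≢M e)) , (λ e → e) ] (Y.only (~-sym adj)))
        go : ∀ {s t} → x ~ s → x ~ t → s ≢ t → s ≡ - x ⊎ s ≡ - y ⊎ s ≡ M - X.u →
             t ≡ - x ⊎ t ≡ - y ⊎ t ≡ M - X.u → x ≡ X.u ⊎ x ≡ Y.u
        go p _ _ (case₁ refl) _ = from-x p
        go p _ _ (case₂ refl) _ = from-y p
        go _ q _ _ (case₁ refl) = from-x q
        go _ q _ _ (case₂ refl) = from-y q
        go _ _ n (inj₂ (inj₂ refl)) (inj₂ (inj₂ refl)) = ⊥-elim (n refl)

      x≢y : x ≢ y
      x≢y e = >⇒≢ y<x e refl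

      -- `crossed` and `uncrossed` both find this value of M and then reach 3x + y by translations,
      -- which is larger because x > y.
      too-big : M ≡ x + x + y + y → ¬ P (x + x + x + y)
      too-big e p = above p y<x (linear (sym e) (solve (M ∷ x ∷ y ∷ [])))

      -- The edge from -x to y keeps x + y out of S. Hence y is joined to 2y + x, which must be M -
      -- x.
      crossed : y ≡ X.u → x ≡ Y.u → ⊥
      crossed y≡u x≡u′ = too-big M≡ (P-cong (is-in 3x+y∈) (solve (x ∷ y ∷ [])))
        where
        ≢y : ∀ t → t ≢ y → t ≢ X.u
        ≢y t n e = n (trans e (sym y≡u))
        ≢x : ∀ t → t ≢ x → t ≢ Y.u
        ≢x t n e = n (trans e (sym x≡u′))
        y+x∉ : ¬ Q (y + x)
        y+x∉ q = ∉ʳ X.-x~u (Q-cong q (trans (cong (_+ x) y≡u) (eq X.u x)))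
          where eq : ∀ u x → u + x ≡ u - - x
                eq = solve-∀
        2x∈ : Q (x + x)
        2x∈ = X.translate (mkQ x>0 x∈) x≢M (≢y x x≢y)
        2y∈ : Q (y + y)
        2y∈ = Y.translate (mkQ y>0 y∈) y≢M (≢x y (λ e → x≢y (sym e)))
        2y≢M : y + y ≢ M
        2y≢M e = above (is-in 2x∈) (y<x ⊕ y<x) (linear e (solve (x ∷ y ∷ M ∷ [])))
        2y+x∈ : Q (y + y + x)
        2y+x∈ = X.translate 2y∈ 2y≢M (≢y (y + y) (λ e → >⇒≢ y>0 e (solve (y ∷ []))))
        y~2y+x : y ~ y + y + x
        y~2y+x = mk~ y∈ (is-in 2y+x∈) (λ e → <⇒≢ (y>0 ⊕ x>0) e (solve (x ∷ y ∷ [])))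
          (λ (mkQ p _) → Pos-absurd (p ⊕ y>0 ⊕ x>0) (solve (x ∷ y ∷ [])))
          (λ q → y+x∉ (Q-cong q (solve (x ∷ y ∷ []))))
        M≡ : M ≡ x + x + y + y
        M≡ = go (NY.neighbours y~2y+x)
          where
          go : y + y + x ≡ - x ⊎ y + y + x ≡ - y ⊎ y + y + x ≡ M - Y.u → M ≡ x + x + y + y
          go (case₁ e) = ⊥-elim (>⇒≢ (y>0 ⊕ y>0 ⊕ x>0 ⊕ x>0) e (solve (x ∷ y ∷ [])))
          go (case₂ e) = ⊥-elim (>⇒≢ (y>0 ⊕ y>0 ⊕ x>0 ⊕ y>0) e (solve (x ∷ y ∷ [])))
          go (inj₂ (inj₂ e)) = linear (sym (trans e (cong (λ u → M - u) (sym x≡u′)))) (solve (x ∷ y ∷ M ∷ []))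
        2x+y∈ : Q (x + x + y)
        2x+y∈ = Y.translate 2x∈ (λ e → <⇒≢ (y>0 ⊕ y>0) (trans e M≡) (solve (x ∷ y ∷ [])))
                  (≢x (x + x) (λ e → >⇒≢ x>0 e (solve (x ∷ []))))
        3x+y∈ : Q (x + x + y + x)
        3x+y∈ = X.translate 2x+y∈ (λ e → <⇒≢ y>0 (trans e M≡) (solve (x ∷ y ∷ [])))
                  (≢y (x + x + y) (λ e → >⇒≢ (x>0 ⊕ x>0) e (solve (x ∷ y ∷ []))))

      -- The edge from -y to y keeps 2y out of S. If x + y is not M, then x + 2y is in S, is joined
      -- to x, and must be M - x.
      uncrossed : x ≡ X.u → y ≡ Y.u → ⊥
      uncrossed x≡u y≡u′ = go ((y + x) ℤₚ.≟ M)
        where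
        ≢x : ∀ t → t ≢ x → t ≢ X.u
        ≢x t n e = n (trans e (sym x≡u))
        ≢y : ∀ t → t ≢ y → t ≢ Y.u
        ≢y t n e = n (trans e (sym y≡u′))
        2y∉ : ¬ Q (y + y)
        2y∉ q = ∉ʳ Y.-x~u (Q-cong q (trans (cong (_+ y) y≡u′) (eq Y.u y)))
          where eq : ∀ u x → u + x ≡ u - - x
                eq = solve-∀
        y+x∈ : Q (y + x)
        y+x∈ = X.translate (mkQ y>0 y∈) y≢M (≢x y (λ e → x≢y (sym e)))
        x≁-y : ¬ x ~ - y
        x≁-y adj = [ x≢M , ≢y x x≢y ] (Y.only (~-sym adj))
        go : Dec (y + x ≡ M) → ⊥
        go (yes y+x≡M) = degree≥2 x∈ (λ adj → options adj (NX.neighbours adj))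
          where
          options : ∀ {t} → x ~ t → t ≡ - x ⊎ t ≡ - y ⊎ t ≡ M - X.u → t ≡ - x
          options adj (case₁ e) = e
          options adj (case₂ refl) = ⊥-elim (x≁-y adj)
          options adj (inj₂ (inj₂ e)) = ⊥-elim (∉ˡ adj (Q-cong x-y∈ (cong (λ z → x - z) (sym t≡y))))
            where
            t≡y : _ ≡ y
            t≡y = trans e (trans (cong (λ u → M - u) (sym x≡u)) (linear (sym y+x≡M) (solve (x ∷ y ∷ M ∷ []))))
        go (no y+x≢M) = too-big M≡ (P-cong (is-in 3x+y∈) (solve (x ∷ y ∷ [])))
          where
          y+x+y∈ : Q (y + x + y)
          y+x+y∈ = Y.translate y+x∈ y+x≢M (≢y (y + x) (λ e → >⇒≢ x>0 e (solve (x ∷ y ∷ []))))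
          x~y+x+y : x ~ y + x + y
          x~y+x+y = mk~ x∈ (is-in y+x+y∈) (λ e → <⇒≢ (y>0 ⊕ y>0) e (solve (x ∷ y ∷ [])))
            (λ (mkQ p _) → Pos-absurd (p ⊕ y>0 ⊕ y>0) (solve (x ∷ y ∷ [])))
            (λ q → 2y∉ (Q-cong q (solve (x ∷ y ∷ []))))
          M≡ : M ≡ x + x + y + y
          M≡ = go′ (NX.neighbours x~y+x+y)
            where
            go′ : y + x + y ≡ - x ⊎ y + x + y ≡ - y ⊎ y + x + y ≡ M - X.u → M ≡ x + x + y + y
            go′ (case₁ e) = ⊥-elim (>⇒≢ (y>0 ⊕ y>0 ⊕ x>0 ⊕ x>0) e (solve (x ∷ y ∷ [])))
            go′ (case₂ e) = ⊥-elim (>⇒≢ (y>0 ⊕ y>0 ⊕ x>0 ⊕ y>0) e (solve (x ∷ y ∷ [])))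
            go′ (inj₂ (inj₂ e)) = linear (sym (trans e (cong (λ u → M - u) (sym x≡u)))) (solve (x ∷ y ∷ M ∷ []))
          2x+y∈ : Q (y + x + x)
          2x+y∈ = X.translate y+x∈ y+x≢M (≢x (y + x) (λ e → >⇒≢ y>0 e (solve (x ∷ y ∷ []))))
          3x+y∈ : Q (y + x + x + x)
          3x+y∈ = X.translate 2x+y∈ (λ e → <⇒≢ y>0 (trans e M≡) (solve (x ∷ y ∷ [])))
                    (≢x (y + x + x) (λ e → >⇒≢ (y>0 ⊕ x>0) e (solve (x ∷ y ∷ []))))

      two-negatives-impossible : ⊥
      two-negatives-impossible = go y≡ x≡
        where
        go : y ≡ X.u ⊎ y ≡ Y.u → x ≡ X.u ⊎ x ≡ Y.u → ⊥
        go (inj₁ e) (inj₁ f) = x≢y (trans f (sym e))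
        go (inj₁ e) (inj₂ f) = crossed e f
        go (inj₂ e) (inj₁ f) = uncrossed f e
        go (inj₂ e) (inj₂ f) = x≢y (trans f (sym e))

    -- One negative element

    module OneNegative {x : ℤ} (x>0 : Pos x) (-x~M : - x ~ M)
                       (negative : ∀ {t} → P t → t ≡ - x ⊎ Pos t) where
      open Translate x>0 -x~M
      open Progression x

      x∈ : P x
      x∈ = disconnected cover
        where
        cover : ∀ {t} → P t → t ~ M ⊎ Pos t
        cover t∈ with negative t∈
        ... | inj₁ refl = inj₁ -x~M
        ... | inj₂ t>0 = inj₂ t>0

      Start : ℤ → Set
      Start s = Q s × ¬ P (s - x)

      Ascends : ℤ → ℤ → Set
      Ascends w s = ∃ λ i → up s i ≡ w × (∀ j → j ℕ.≤ i → P (up s j))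

      up-+x : ∀ s i → up (s + x) i ≡ up s i + x
      up-+x s i = up-translate s x i

      ascends-suc : ∀ {w s} → P s → Ascends w (s + x) → Ascends w s
      ascends-suc {w} {s} s∈ (i , e , f) = suc i , trans (sym (up-+x s i)) e , g
        where
        g : ∀ j → j ℕ.≤ suc i → P (up s j)
        g zero _ = s∈
        g (suc j) (ℕ.s≤s j≤i) = P-cong (f j j≤i) (up-+x s j)

      ascend-fuel : ∀ n {t} → Q t → Pos (+ n - (M - t)) → Ascends M t ⊎ Ascends u t
      ascend-fuel zero {t} q r = ⊥-elim (above (is-in q) r (solve (M ∷ t ∷ [])))
      ascend-fuel (suc n) {t} q r = go (t ℤₚ.≟ M) (t ℤₚ.≟ u)
        where
        at-top : ∀ j → j ℕ.≤ 0 → P (up t j)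
        at-top zero _ = is-in q
        go : Dec (t ≡ M) → Dec (t ≡ u) → Ascends M t ⊎ Ascends u t
        go (yes e) _ = inj₁ (0 , e , at-top)
        go _ (yes e) = inj₂ (0 , e , at-top)
        go (no t≢M) (no t≢u) with ascend-fuel n (translate q t≢M t≢u) (Pos-cong (Pos-pred r x>0) (eq (+ n) M t x))
          where eq : ∀ n M t x → 1ℤ + n - (M - t) + x - 1ℤ ≡ n - (M - (t + x))
                eq = solve-∀
        ... | inj₁ a = inj₁ (ascends-suc (is-in q) a)
        ... | inj₂ a = inj₂ (ascends-suc (is-in q) a)

      ascend : ∀ {t} → Q t → Ascends M t ⊎ Ascends u t
      ascend {t} q with M-greatest (is-in q)
      ... | inj₁ e = inj₁ (0 , e , λ { zero _ → is-in q })
      ... | inj₂ p with M - t in e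
      ... | + n = ascend-fuel (suc n) q
            (Pos-cong (+<+ (ℕ.s≤s (ℕ.z≤n {0}))) (trans (eq (+ n)) (cong (λ z → 1ℤ + + n - z) (sym e))))
        where eq : ∀ n → 1ℤ ≡ 1ℤ + n - n
              eq = solve-∀

      -- Walking down from the common top, the start met first would have a predecessor in the other
      -- progression.
      same-top : ∀ {w s t} → Start s → Start t → Ascends w s → Ascends w t → s ≡ t
      same-top {w} {s} {t} (_ , s-x∉) (_ , t-x∉) (i , e , f) (j , e′ , g) = go i j f g (trans e (sym e′))
        where
        go : ∀ i j → (∀ k → k ℕ.≤ i → P (up s k)) → (∀ k → k ℕ.≤ j → P (up t k)) → up s i ≡ up t j → s ≡ t
        go zero zero _ _ e = e
        go (suc i) (suc j) f g e = go i j (λ k k≤i → f k (ℕₚ.m≤n⇒m≤1+n k≤i)) (λ k k≤j → g k (ℕₚ.m≤n⇒m≤1+n k≤j))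
          (linear e (eq (up s i) (up t j) x))
          where eq : ∀ a b x → a - b ≡ a + x - (b + x)
                eq = solve-∀
        go zero (suc j) _ g e = ⊥-elim (s-x∉ (P-cong (g j (ℕₚ.n≤1+n j)) (linear (sym e) (eq (up t j) s x))))
          where eq : ∀ a s x → a - (s - x) ≡ a + x - s
                eq = solve-∀
        go (suc i) zero f _ e = ⊥-elim (t-x∉ (P-cong (f i (ℕₚ.n≤1+n i)) (linear e (eq (up s i) t x))))
          where eq : ∀ a s x → a - (s - x) ≡ a + x - s
                eq = solve-∀

      -- Two elements have no successor (M and u), so at most two have no predecessor.
      three-starts : ∀ {r s t} → Start r → Start s → Start t → r ≢ s → r ≢ t → s ≢ t → ⊥
      three-starts a b c r≢s r≢t s≢t with ascend (proj₁ a) | ascend (proj₁ b) | ascend (proj₁ c)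
      ... | inj₁ p | inj₁ q | _ = r≢s (same-top a b p q)
      ... | inj₂ p | inj₂ q | _ = r≢s (same-top a b p q)
      ... | inj₁ p | inj₂ q | inj₁ r = r≢t (same-top a c p r)
      ... | inj₁ p | inj₂ q | inj₂ r = s≢t (same-top b c q r)
      ... | inj₂ p | inj₁ q | inj₁ r = s≢t (same-top b c q r)
      ... | inj₂ p | inj₁ q | inj₂ r = r≢t (same-top a c p r)

      start-x : Start x
      start-x = mkQ x>0 x∈ , λ p → 0∉ (P-cong p (solve (x ∷ [])))

      -- A positive t - x in S contradicts the edge, and the only negative value, -x, would make t
      -- zero.
      neighbour-start : ∀ {t} → x ~ t → t ≡ - x ⊎ Start t
      neighbour-start {t} adj = go (negative (∈ʳ adj))
        where
        go : t ≡ - x ⊎ Pos t → t ≡ - x ⊎ Start t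
        go (inj₁ e) = inj₁ e
        go (inj₂ t>0) = inj₂ (mkQ t>0 (∈ʳ adj) , λ p → no-difference p (negative p))
          where
          no-difference : P (t - x) → t - x ≡ - x ⊎ Pos (t - x) → ⊥
          no-difference p (inj₁ e) = >⇒≢ t>0 e (solve (t ∷ x ∷ []))
          no-difference p (inj₂ q) = ∉ʳ adj (mkQ q p)

      module _ {g : ℤ} (x~-x : x ~ - x) (x~g : x ~ g) (start-g : Start g) where
        g>0 : Pos g
        g>0 = is-pos (proj₁ start-g)

        g≢x : g ≢ x
        g≢x e = distinct x~g (sym e)

        2x∉ : ¬ P (x + x)
        2x∉ p = ∉ˡ x~-x (Q-cong (mkQ (x>0 ⊕ x>0) p) (solve (x ∷ [])))

        start≡ : ∀ {t} → Start t → t ≡ x ⊎ t ≡ g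
        start≡ {t} s with t ℤₚ.≟ x | t ℤₚ.≟ g
        ... | yes e | _ = inj₁ e
        ... | no _ | yes e = inj₂ e
        ... | no n | no m = ⊥-elim (three-starts start-x start-g s (λ e → g≢x (sym e)) (λ e → n (sym e)) (λ e → m (sym e)))

        descend : ∀ {t} → P t → t ≡ - x ⊎ t ≡ x ⊎ t ≡ g ⊎ P (t - x)
        descend {t} t∈ = go (negative t∈) (P? (t - x))
          where
          go : t ≡ - x ⊎ Pos t → Dec (P (t - x)) → t ≡ - x ⊎ t ≡ x ⊎ t ≡ g ⊎ P (t - x)
          go (inj₁ e) _ = case₁ e
          go (inj₂ _) (yes p) = case₄ p
          go (inj₂ t>0) (no ∉) with start≡ (mkQ t>0 t∈ , ∉)
          ... | inj₁ e = case₂ e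
          ... | inj₂ e = case₃ e

        bound : ∀ {t} → P t → Pos (t - (- x - x))
        bound {t} t∈ = go (negative t∈)
          where
          go : t ≡ - x ⊎ Pos t → Pos (t - (- x - x))
          go (inj₁ e) = Pos-cong x>0 (linear (sym e) (solve (t ∷ x ∷ [])))
          go (inj₂ t>0) = Pos-cong (t>0 ⊕ x>0 ⊕ x>0) (solve (t ∷ x ∷ []))

        open Chains C x (- x - x) x>0 bound (- x) x g descend using (long-enough)

        -- The progression from -x stops before 0 and the one from x before 2x, so all but two
        -- elements lie over g.
        chain : ∀ j → 1 ℕ.+ (1 ℕ.+ j) ℕ.< 8 → P (up g j)
        chain j lt = long-enough 1 1 j lt (λ p → 0∉ (P-cong p (ℤₚ.+-inverseˡ x))) 2x∉

        g+x∈ : P (g + x)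
        g+x∈ = chain 1 (ℕₚ.m≤m+n 4 4)
        g+2x∈ : P (g + x + x)
        g+2x∈ = chain 2 (ℕₚ.m≤m+n 5 3)
        g∈ : P g
        g∈ = ∈ʳ x~g

        g~g+2x : g ~ g + x + x
        g~g+2x = mk~ g∈ g+2x∈ (λ e → <⇒≢ (x>0 ⊕ x>0) e (solve (x ∷ g ∷ [])))
          (λ (mkQ p _) → Pos-absurd (p ⊕ x>0 ⊕ x>0) (solve (x ∷ g ∷ [])))
          (λ (mkQ _ p) → 2x∉ (P-cong p (solve (x ∷ g ∷ []))))

        x≢g+2x : x ≢ g + x + x
        x≢g+2x e = <⇒≢ (g>0 ⊕ x>0) e (solve (x ∷ g ∷ []))

        -- The neighbours of g are x and g + 2x. Translated, they offer g + x only 2x, which is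
        -- missing, and g + 3x.
        too-few-neighbours : ⊥
        too-few-neighbours = degree≥2 g+x∈ (λ adj → options adj (descend (∈ʳ adj)))
          where
          options : ∀ {t} → g + x ~ t → t ≡ - x ⊎ t ≡ x ⊎ t ≡ g ⊎ P (t - x) → t ≡ g + x + x + x
          options adj (case₁ refl) = ⊥-elim (∉ˡ adj (Q-cong (mkQ (g>0 ⊕ x>0 ⊕ x>0) g+2x∈) (solve (x ∷ g ∷ []))))
          options adj (case₂ refl) = ⊥-elim (∉ˡ adj (Q-cong (mkQ g>0 g∈) (solve (x ∷ g ∷ []))))
          options adj (case₃ refl) = ⊥-elim (∉ˡ adj (Q-cong (mkQ x>0 x∈) (solve (x ∷ g ∷ []))))
          options {t} adj (inj₂ (inj₂ (inj₂ p))) = shifted (full (~-sym x~g) g~g+2x x≢g+2x g~t-x)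
            where
            g~t-x : g ~ t - x
            g~t-x = mk~ g∈ p (λ e → distinct adj (linear e (solve (x ∷ g ∷ t ∷ []))))
              (λ q → ∉ˡ adj (Q-cong q (solve (x ∷ g ∷ t ∷ []))))
              (λ q → ∉ʳ adj (Q-cong q (solve (x ∷ g ∷ t ∷ []))))
            shifted : t - x ≡ x ⊎ t - x ≡ g + x + x → t ≡ g + x + x + x
            shifted (inj₁ e) = ⊥-elim (2x∉ (P-cong (∈ʳ adj) (linear e (solve (x ∷ t ∷ [])))))
            shifted (inj₂ e) = linear e (solve (x ∷ g ∷ t ∷ []))

      -- Since x is itself a start, its neighbours cannot both be starts, so one of them is -x.
      one-negative-impossible : ⊥
      one-negative-impossible with degree x∈
      ... | s , t , x~s , x~t , s≢t , _ = go x~s x~t s≢t (neighbour-start x~s) (neighbour-start x~t)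
        where
        go : ∀ {s t} → x ~ s → x ~ t → s ≢ t → s ≡ - x ⊎ Start s → t ≡ - x ⊎ Start t → ⊥
        go p q n (inj₁ refl) (inj₁ refl) = n refl
        go p q n (inj₁ refl) (inj₂ start) = too-few-neighbours p q start
        go p q n (inj₂ start) (inj₁ refl) = too-few-neighbours q p start
        go p q n (inj₂ start) (inj₂ start′) = three-starts start-x start start′ (distinct p) (distinct q) n

  impossible : ⊥
  impossible with minimum | maximum
  ... | m , m∈ , least | M , M∈ , greatest = go (sign m)
    where
    open Top M∈ greatest
    go : Pos m ⊎ m ≡ 0ℤ ⊎ Pos (- m) → ⊥
    go (inj₁ m>0) = PositiveCase.positive-impossible C positive
      where
      positive : ∀ {t} → P t → Pos t
      positive {t} t∈ with least t∈
      ... | inj₁ refl = m>0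
      ... | inj₂ p = Pos-cong (p ⊕ m>0) (solve (t ∷ m ∷ []))
    go (inj₂ (inj₁ refl)) = 0∉ m∈
    go (inj₂ (inj₂ x>0)) = second (other M~-x)
      where
      -m≡ : - - m ≡ m
      -m≡ = ℤₚ.neg-involutive m
      M~-x : M ~ - - m
      M~-x = subst (M ~_) (sym -m≡) (~-sym (negative~M m∈ x>0))
      second : (∃ λ z → M ~ z × z ≢ - - m) → ⊥
      second (z , M~z , z≢) = by-sign (sign z)
        where
        known : ∀ {t} → P t → t ≡ - - m ⊎ t ≡ z ⊎ Pos t
        known {t} t∈ with sign t
        ... | inj₁ p = inj₂ (inj₂ p)
        ... | inj₂ (inj₁ refl) = ⊥-elim (0∉ t∈)
        ... | inj₂ (inj₂ t<0) with full M~-x M~z (λ e → z≢ (sym e)) (~-sym (negative~M t∈ t<0))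
        ... | inj₁ e = inj₁ e
        ... | inj₂ e = inj₂ (inj₁ e)
        by-sign : Pos z ⊎ z ≡ 0ℤ ⊎ Pos (- z) → ⊥
        by-sign (inj₁ z>0) = OneNegative.one-negative-impossible x>0 (~-sym M~-x) negative
          where
          negative : ∀ {t} → P t → t ≡ - - m ⊎ Pos t
          negative t∈ with known t∈
          ... | case₁ e = inj₁ e
          ... | case₂ refl = inj₂ z>0
          ... | inj₂ (inj₂ p) = inj₂ p
        by-sign (inj₂ (inj₁ refl)) = 0∉ (∈ʳ M~z)
        by-sign (inj₂ (inj₂ y>0)) = TwoNegatives.two-negatives-impossible y>0 z>m M~-x
            (subst (M ~_) (sym (ℤₚ.neg-involutive z)) M~z) negative
          where
          z>m : Pos (- m - - z)
          z>m with least (∈ʳ M~z)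
          ... | inj₁ e = ⊥-elim (z≢ (trans e (sym -m≡)))
          ... | inj₂ p = Pos-cong p (solve (z ∷ m ∷ []))
          negative : ∀ {t} → P t → t ≡ - - m ⊎ t ≡ - - z ⊎ Pos t
          negative t∈ with known t∈
          ... | case₁ e = case₁ e
          ... | case₂ e = case₂ (trans e (sym (ℤₚ.neg-involutive z)))
          ... | inj₂ (inj₂ p) = inj₂ (inj₂ p)

-- The two cycles

module Cycle (m′ : ℕ) (3≤m′ : 3 ℕ.≤ m′) where
  m : ℕ
  m = suc m′

  -- Separating the wrap-around from the ordinary step replaces remainders by pattern matching.
  Next : ℕ → ℕ → Set
  Next a b = b ≡ suc a ⊎ (a ≡ m′ × b ≡ 0)

  %⇒Next : ∀ {a b} → a ℕ.< m → b ≡ (a ℕ.+ 1) % m → Next a b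
  %⇒Next {a} (ℕ.s≤s a≤m′) e with ℕₚ.m≤n⇒m<n∨m≡n a≤m′
  ... | inj₁ a<m′ = inj₁ (trans e (trans (cong (_% m) (ℕₚ.+-comm a 1)) (m<n⇒m%n≡m (ℕ.s≤s a<m′))))
  ... | inj₂ refl = inj₂ (refl , trans e (trans (cong (_% m) (ℕₚ.+-comm a 1)) (n%n≡0 m)))

  Next⇒% : ∀ {a b} → b ℕ.< m → Next a b → b ≡ (a ℕ.+ 1) % m
  Next⇒% {a} b<m (inj₁ refl) = sym (trans (cong (_% m) (ℕₚ.+-comm a 1)) (m<n⇒m%n≡m b<m))
  Next⇒% {a} _ (inj₂ (refl , refl)) = sym (trans (cong (_% m) (ℕₚ.+-comm a 1)) (n%n≡0 m))

  Next-functional : ∀ {a b c} → b ℕ.< m → c ℕ.< m → Next a b → Next a c → b ≡ c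
  Next-functional b< c< p q = trans (Next⇒% b< p) (sym (Next⇒% c< q))

  Next-injective : ∀ {a b c} → Next a c → Next b c → a ≡ b
  Next-injective (inj₁ refl) (inj₁ refl) = refl
  Next-injective (inj₂ (refl , refl)) (inj₂ (refl , _)) = refl

  ¬1-cycle : ∀ {a} → ¬ Next a a
  ¬1-cycle (inj₂ (refl , refl)) = ℕₚ.<⇒≱ (ℕ.s≤s ℕ.z≤n) 3≤m′

  ¬2-cycle : ∀ {a b} → Next a b → Next b a → ⊥
  ¬2-cycle (inj₁ refl) (inj₂ (refl , refl)) = ℕₚ.<⇒≱ (ℕ.s≤s (ℕ.s≤s ℕ.z≤n)) 3≤m′
  ¬2-cycle (inj₂ (refl , refl)) (inj₁ refl) = ℕₚ.<⇒≱ (ℕ.s≤s (ℕ.s≤s ℕ.z≤n)) 3≤m′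
  ¬2-cycle (inj₂ (refl , refl)) (inj₂ (refl , _)) = ℕₚ.<⇒≱ (ℕ.s≤s ℕ.z≤n) 3≤m′

  ¬3-cycle : ∀ {a b c} → Next a b → Next b c → Next c a → ⊥
  ¬3-cycle (inj₁ refl) (inj₁ refl) (inj₂ (refl , refl)) = ℕₚ.<⇒≱ (ℕ.s≤s (ℕ.s≤s (ℕ.s≤s ℕ.z≤n))) 3≤m′
  ¬3-cycle (inj₁ refl) (inj₂ (refl , refl)) (inj₁ refl) = ℕₚ.<⇒≱ (ℕ.s≤s (ℕ.s≤s (ℕ.s≤s ℕ.z≤n))) 3≤m′
  ¬3-cycle (inj₂ (refl , refl)) (inj₁ refl) (inj₁ refl) = ℕₚ.<⇒≱ (ℕ.s≤s (ℕ.s≤s (ℕ.s≤s ℕ.z≤n))) 3≤m′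
  ¬3-cycle (inj₂ (refl , refl)) (inj₁ refl) (inj₂ (refl , e)) = ℕₚ.<⇒≱ (ℕ.s≤s (ℕ.s≤s ℕ.z≤n)) 3≤m′
  ¬3-cycle (inj₂ (refl , refl)) (inj₂ (refl , _)) _ = ℕₚ.<⇒≱ (ℕ.s≤s ℕ.z≤n) 3≤m′

  Edge : Fin m → Fin m → Set
  Edge i j = Next (toℕ i) (toℕ j) ⊎ Next (toℕ j) (toℕ i)

  CycleAdj⇒Edge : ∀ i j → CycleAdj m′ i j → Edge i j
  CycleAdj⇒Edge i j (inj₁ e) = inj₁ (%⇒Next (Finₚ.toℕ<n i) e)
  CycleAdj⇒Edge i j (inj₂ e) = inj₂ (%⇒Next (Finₚ.toℕ<n j) e)

  Edge⇒CycleAdj : ∀ i j → Edge i j → CycleAdj m′ i j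
  Edge⇒CycleAdj i j (inj₁ e) = inj₁ (Next⇒% (Finₚ.toℕ<n j) e)
  Edge⇒CycleAdj i j (inj₂ e) = inj₂ (Next⇒% (Finₚ.toℕ<n i) e)

  Edge-irreflexive : ∀ {i} → ¬ Edge i i
  Edge-irreflexive (inj₁ p) = ¬1-cycle p
  Edge-irreflexive (inj₂ p) = ¬1-cycle p

  next prev : Fin m → Fin m
  next i = fromℕ< (m%n<n (toℕ i ℕ.+ 1) m)
  prev Fin.zero = fromℕ m′
  prev (Fin.suc i) = inject₁ i

  next-Next : ∀ i → Next (toℕ i) (toℕ (next i))
  next-Next i = %⇒Next (Finₚ.toℕ<n i) (Finₚ.toℕ-fromℕ< _)

  prev-Next : ∀ i → Next (toℕ (prev i)) (toℕ i)
  prev-Next Fin.zero = inj₂ (Finₚ.toℕ-fromℕ m′ , refl)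
  prev-Next (Fin.suc i) = inj₁ (cong suc (sym (Finₚ.toℕ-inject₁ i)))

  next≢prev : ∀ i → next i ≢ prev i
  next≢prev i e = ¬2-cycle (next-Next i) (subst (λ j → Next (toℕ j) (toℕ i)) (sym e) (prev-Next i))

  Edge-only : ∀ {i j} → Edge i j → j ≡ next i ⊎ j ≡ prev i
  Edge-only {i} {j} (inj₁ p) = inj₁ (Finₚ.toℕ-injective
    (Next-functional (Finₚ.toℕ<n j) (Finₚ.toℕ<n (next i)) p (next-Next i)))
  Edge-only {i} {j} (inj₂ p) = inj₂ (Finₚ.toℕ-injective (Next-injective p (prev-Next i)))

  same : ∀ {i j l : Fin m} → Next (toℕ i) (toℕ j) → Next (toℕ i) (toℕ l) → j ≡ l
  same {i} {j} {l} p q = Finₚ.toℕ-injective (Next-functional (Finₚ.toℕ<n j) (Finₚ.toℕ<n l) p q)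

  -- Orient the edges along `Next`: a triangle is a directed 3-cycle, impossible for m at least 4,
  -- or two of its edges leave or enter the same vertex, and then their other ends coincide.
  Edge-triangle-free : ∀ {i j l} → Edge i j → Edge j l → Edge i l → ⊥
  Edge-triangle-free (inj₁ p) (inj₁ q) (inj₂ r) = ¬3-cycle p q r
  Edge-triangle-free (inj₂ p) (inj₂ q) (inj₁ r) = ¬3-cycle r q p
  Edge-triangle-free (inj₁ p) e (inj₁ r) with same p r
  ... | refl = Edge-irreflexive e
  Edge-triangle-free (inj₂ p) (inj₁ q) e with same p q
  ... | refl = Edge-irreflexive e
  Edge-triangle-free {i} {j} {l} (inj₁ p) (inj₂ q) e with Finₚ.toℕ-injective {i = i} {j = l} (Next-injective p q)
  ... | refl = Edge-irreflexive e
  Edge-triangle-free {i} {j} {l} (inj₂ p) (inj₂ q) (inj₂ r) with Finₚ.toℕ-injective {i = j} {j = l} (Next-injective p r)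
  ... | refl = Edge-irreflexive (inj₁ q)

  side : GVertex m′ → Bool
  side (inj₁ _) = true
  side (inj₂ _) = false

  TwoCycles-side : ∀ u v → TwoCyclesAdj m′ u v → side u ≡ side v
  TwoCycles-side (inj₁ _) (inj₁ _) _ = refl
  TwoCycles-side (inj₂ _) (inj₂ _) _ = refl

  TwoCycles-irreflexive : ∀ u → ¬ TwoCyclesAdj m′ u u
  TwoCycles-irreflexive (inj₁ i) e = Edge-irreflexive (CycleAdj⇒Edge i i e)
  TwoCycles-irreflexive (inj₂ i) e = Edge-irreflexive (CycleAdj⇒Edge i i e)

  TwoCycles? : ∀ u v → Dec (TwoCyclesAdj m′ u v)
  TwoCycles? (inj₁ i) (inj₁ j) = (_ ℕₚ.≟ _) ⊎-dec (_ ℕₚ.≟ _)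
  TwoCycles? (inj₂ i) (inj₂ j) = (_ ℕₚ.≟ _) ⊎-dec (_ ℕₚ.≟ _)
  TwoCycles? (inj₁ _) (inj₂ _) = no λ ()
  TwoCycles? (inj₂ _) (inj₁ _) = no λ ()

  TwoCycles-triangle-free : ∀ u v w → TwoCyclesAdj m′ u v → TwoCyclesAdj m′ v w → TwoCyclesAdj m′ u w → ⊥
  TwoCycles-triangle-free (inj₁ i) (inj₁ j) (inj₁ l) p q r =
    Edge-triangle-free (CycleAdj⇒Edge i j p) (CycleAdj⇒Edge j l q) (CycleAdj⇒Edge i l r)
  TwoCycles-triangle-free (inj₂ i) (inj₂ j) (inj₂ l) p q r =
    Edge-triangle-free (CycleAdj⇒Edge i j p) (CycleAdj⇒Edge j l q) (CycleAdj⇒Edge i l r)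

  TwoCycles-degree : ∀ u → ∃₂ λ v w → TwoCyclesAdj m′ u v × TwoCyclesAdj m′ u w × v ≢ w ×
                     (∀ t → TwoCyclesAdj m′ u t → t ≡ v ⊎ t ≡ w)
  TwoCycles-degree (inj₁ i) = inj₁ (next i) , inj₁ (prev i) ,
    Edge⇒CycleAdj i (next i) (inj₁ (next-Next i)) , Edge⇒CycleAdj i (prev i) (inj₂ (prev-Next i)) ,
    (λ { e → next≢prev i (inj₁-injective e) }) , only
    where
    only : ∀ t → TwoCyclesAdj m′ (inj₁ i) t → t ≡ inj₁ (next i) ⊎ t ≡ inj₁ (prev i)
    only (inj₁ j) e with Edge-only (CycleAdj⇒Edge i j e)
    ... | inj₁ refl = inj₁ refl
    ... | inj₂ refl = inj₂ refl
  TwoCycles-degree (inj₂ i) = inj₂ (next i) , inj₂ (prev i) ,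
    Edge⇒CycleAdj i (next i) (inj₁ (next-Next i)) , Edge⇒CycleAdj i (prev i) (inj₂ (prev-Next i)) ,
    (λ { e → next≢prev i (inj₂-injective e) }) , only
    where
    only : ∀ t → TwoCyclesAdj m′ (inj₂ i) t → t ≡ inj₂ (next i) ⊎ t ≡ inj₂ (prev i)
    only (inj₂ j) e with Edge-only (CycleAdj⇒Edge i j e)
    ... | inj₁ refl = inj₁ refl
    ... | inj₂ refl = inj₂ refl

-- From indices to values

-- If `xs` held all values, their positions would violate the pigeonhole principle.
escape : ∀ {A : Set} {k} (f : Fin k → A) → Injective _≡_ _≡_ f → DecidableEquality A →
         (xs : List A) → length xs ℕ.< k → ∃ λ i → f i ∉ xs
escape {k = k} f f-inj _≟_ xs lt = Finₚ.¬∀⟶∃¬ k _ (λ i → f i ∈? xs) all∈⇒⊥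
  where
  open DecMembership _≟_ using (_∈?_)
  all∈⇒⊥ : ¬ (∀ i → f i ∈ xs)
  all∈⇒⊥ all∈ with Finₚ.pigeonhole lt (λ i → index (all∈ i))
  ... | i , j , i<j , e = ℕₚ.<⇒≢ i<j (cong toℕ (f-inj
          (trans (lookup-index (all∈ i)) (trans (cong (lookup xs) e) (sym (lookup-index (all∈ j)))))))

argmax : ∀ {k} (f : Fin k → ℤ) {R : Fin k → Set} → Decidable R → ∃ R →
         ∃ λ i → R i × (∀ j → R j → f j ℤ.≤ f i)
argmax {suc k} f {R} R? ∃R with R? Fin.zero | Finₚ.any? (λ i → R? (Fin.suc i))
... | no ¬r | no ¬∃ = ⊥-elim (none ∃R)
  where
  none : ¬ ∃ R
  none (Fin.zero , r) = ¬r r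
  none (Fin.suc i , r) = ¬∃ (i , r)
... | yes r | no ¬∃ = Fin.zero , r , λ { Fin.zero _ → ℤₚ.≤-refl ; (Fin.suc j) rj → ⊥-elim (¬∃ (j , rj)) }
... | r? | yes ∃R′ with argmax (λ i → f (Fin.suc i)) (λ i → R? (Fin.suc i)) ∃R′
... | i , ri , greatest = best r?
  where
  best : Dec (R Fin.zero) → ∃ λ i → R i × (∀ j → R j → f j ℤ.≤ f i)
  best (no ¬r) = Fin.suc i , ri , λ { Fin.zero r → ⊥-elim (¬r r) ; (Fin.suc j) rj → greatest j rj }
  best (yes r) with ℤₚ.≤-total (f Fin.zero) (f (Fin.suc i))
  ... | inj₁ le = Fin.suc i , ri , λ { Fin.zero _ → le ; (Fin.suc j) rj → greatest j rj }
  ... | inj₂ ge = Fin.zero , r , λ { Fin.zero _ → ℤₚ.≤-refl ; (Fin.suc j) rj → ℤₚ.≤-trans (greatest j rj) ge }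

Pos⇒∣∣ : ∀ {z} → Pos z → + ∣ z ∣ ≡ z
Pos⇒∣∣ p = ℤₚ.0≤i⇒+∣i∣≡i (ℤₚ.<⇒≤ p)

≤⇒¬Pos : ∀ {i j} → i ℤ.≤ j → ¬ Pos (i - j)
≤⇒¬Pos {i} {j} i≤j p = ℤₚ.<⇒≱ p (ℤₚ.i≤j⇒i-j≤0 i≤j)

≤-⊕ : ∀ {i j w} → i ℤ.≤ j → Pos w → Pos (w + (j - i))
≤-⊕ i≤j p = ℤₚ.+-mono-<-≤ p (ℤₚ.i≤j⇒0≤j-i i≤j)

module Signature {k : ℕ} (S : Fin k → ℤ) where
  Mem : ℤ → Set
  Mem z = ∃ λ l → S l ≡ z

  Mem? : ∀ z → Dec (Mem z)
  Mem? z = Finₚ.any? (λ l → S l ℤₚ.≟ z)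

  NonAdj : Fin k → Fin k → Set
  NonAdj i j = i ≢ j × ¬ Mem (+ ∣ S i - S j ∣)

  record TwoRegular : Set where
    field
      size : 8 ℕ.≤ k
      degree : ∀ i → ∃₂ λ j l → NonAdj i j × NonAdj i l × j ≢ l × (∀ {t} → NonAdj i t → t ≡ j ⊎ t ≡ l)
      triangle-free : ∀ {i j l} → NonAdj i j → NonAdj j l → NonAdj i l → ⊥
      side : Fin k → Bool
      side-NonAdj : ∀ {i j} → NonAdj i j → side i ≡ side j
      side-mixed : ∃₂ λ i j → side i ≢ side j

  module Contradiction (G : TwoRegular) where
    open TwoRegular G

    NonAdj-sym : ∀ {i j} → NonAdj i j → NonAdj j i
    NonAdj-sym {i} {j} (i≢j , ∉) = (λ e → i≢j (sym e)) , λ m → ∉ (subst Mem (cong +_ (ℤₚ.∣i-j∣≡∣j-i∣ (S j) (S i))) m)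

    adjacent : ∀ {i j} → i ≢ j → ¬ NonAdj i j → Mem (+ ∣ S i - S j ∣)
    adjacent i≢j ¬na = decidable-stable (Mem? _) (λ ∉ → ¬na (i≢j , ∉))

    full : ∀ {i a b t} → NonAdj i a → NonAdj i b → a ≢ b → NonAdj i t → t ≡ a ⊎ t ≡ b
    full {i} na nb a≢b nt with degree i
    ... | _ , _ , _ , _ , _ , only with only na | only nb | only nt
    ... | inj₁ refl | inj₁ refl | _ = ⊥-elim (a≢b refl)
    ... | inj₂ refl | inj₂ refl | _ = ⊥-elim (a≢b refl)
    ... | inj₁ refl | inj₂ refl | w = w
    ... | inj₂ refl | inj₁ refl | inj₁ e = inj₂ e
    ... | inj₂ refl | inj₁ refl | inj₂ e = inj₁ e

    fresh-index : ∀ xs → length xs ℕ.< 8 → ∃ λ i → i ∉ xs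
    fresh-index xs lt = escape (λ i → i) (λ e → e) Finₚ._≟_ xs (ℕₚ.≤-trans lt size)

    module ZeroElement (z : Fin k) (Sz≡0 : S z ≡ 0ℤ) where
      neighbour<0 : ∀ {i} → NonAdj z i → Pos (- S i)
      neighbour<0 {i} (_ , ∉) = go (sign (S i))
        where
        distance : ∣ S z - S i ∣ ≡ ∣ S i ∣
        distance = trans (ℤₚ.∣i-j∣≡∣j-i∣ (S z) (S i))
                     (cong ∣_∣ (trans (cong (λ w → S i - w) Sz≡0) (ℤₚ.+-identityʳ (S i))))
        nonneg : S i ≡ + ∣ S i ∣ → ⊥
        nonneg e = ∉ (i , trans e (cong +_ (sym distance)))
        go : Pos (S i) ⊎ S i ≡ 0ℤ ⊎ Pos (- S i) → Pos (- S i)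
        go (inj₁ p) = ⊥-elim (nonneg (sym (Pos⇒∣∣ p)))
        go (inj₂ (inj₁ e)) = ⊥-elim (nonneg (trans e (cong (λ w → + ∣ w ∣) (sym e))))
        go (inj₂ (inj₂ p)) = p

      -- The neighbours u and v of z have negative values, hence are also the neighbours of M, the
      -- greatest index apart from z. For the greatest remaining t, the value S t - S u is in S and
      -- exceeds S t, so it is S M. Then M and t are as far apart as z and u, yet adjacent in the
      -- graph.
      impossible : ⊥
      impossible with degree z
      ... | u , v , z-u , z-v , u≢v , z-only with argmax S {_≢ z} (λ i → ¬? (i Finₚ.≟ z)) (u , λ e → proj₁ z-u (sym e))
      ... | M , M≢z , greatest = go (fresh-index (z ∷ M ∷ u ∷ v ∷ []) (ℕₚ.m≤m+n 5 3))
        where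
        Su<0 : Pos (- S u)
        Su<0 = neighbour<0 z-u
        Sv<0 : Pos (- S v)
        Sv<0 = neighbour<0 z-v

        not-z : ∀ {l} → Pos (S l) → l ≢ z
        not-z p refl = Pos-absurd p Sz≡0

        bounded : ∀ {w} → Mem w → Pos w → Pos (w - S M) → ⊥
        bounded (l , refl) p q = ≤⇒¬Pos (greatest l (not-z p)) q

        SM≥0 : ¬ Pos (- S M)
        SM≥0 SM<0 = go (fresh-index (z ∷ u ∷ v ∷ []) (ℕₚ.m≤m+n 4 4))
          where
          go : (∃ λ w → w ∉ z ∷ u ∷ v ∷ []) → ⊥
          go (w , w∉) = bounded (subst Mem (Pos⇒∣∣ Sw<0) near) Sw<0 (Sw<0 ⊕ SM<0)
            where
            w≢z : w ≢ z
            w≢z e = w∉ (here e)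
            near : Mem (+ ∣ S z - S w ∣)
            near = adjacent (λ e → w≢z (sym e)) (λ na → [ (λ e → w∉ (there (here e))) , (λ e → w∉ (there (there (here e)))) ] (z-only na))
            Sw<0 : Pos (S z - S w)
            Sw<0 = Pos-cong (≤-⊕ (greatest w w≢z) SM<0) (trans (eq (S M) (S w)) (cong (_- S w) (sym Sz≡0)))
              where eq : ∀ m w → - m + (m - w) ≡ 0ℤ - w
                    eq = solve-∀

        far : ∀ {n} → Pos (- S n) → NonAdj M n
        far {n} Sn<0 = (λ { refl → SM≥0 Sn<0 }) , λ m → bounded (subst Mem (Pos⇒∣∣ gap) m) gap
            (Pos-cong Sn<0 (eq (S M) (S n)))
          where
          gap : Pos (S M - S n)
          gap = Pos-cong (≤-⊕ (ℤₚ.≮⇒≥ (λ SM<0 → SM≥0 (ℤₚ.neg-mono-< {S M} {0ℤ} SM<0))) Sn<0) (eq (S M) (S n))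
            where eq : ∀ m n → - n + (m - 0ℤ) ≡ m - n
                  eq = solve-∀
          eq : ∀ m n → - n ≡ m - n - m
          eq = solve-∀

        xs : List (Fin k)
        xs = z ∷ M ∷ u ∷ v ∷ []

        go : (∃ λ i → i ∉ xs) → ⊥
        go some with argmax S {_∉ xs} (λ i → ¬? (DecMembership._∈?_ Finₚ._≟_ i xs)) some
        ... | t , t∉ , t-greatest = at-M near-u
          where
          M≁t : ¬ NonAdj M t
          M≁t na = [ (λ e → t∉ (there (there (here e)))) , (λ e → t∉ (there (there (there (here e))))) ]
                     (full (far Su<0) (far Sv<0) u≢v na)
          u≁t : ¬ NonAdj u t
          u≁t na = [ (λ e → t∉ (here e)) , (λ e → t∉ (there (here e))) ]
                     (full (NonAdj-sym z-u) (NonAdj-sym (far Su<0)) (λ e → M≢z (sym e)) na)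
          gap : Pos (S t - S u)
          gap = Pos-cong (≤-⊕ (ℤₚ.≮⇒≥ (λ St<0 → M≁t (far (ℤₚ.neg-mono-< {S t} {0ℤ} St<0)))) Su<0) (eq (S t) (S u))
            where eq : ∀ m n → - n + (m - 0ℤ) ≡ m - n
                  eq = solve-∀
          near-u : Mem (S t - S u)
          near-u = subst Mem (trans (cong +_ (ℤₚ.∣i-j∣≡∣j-i∣ (S u) (S t))) (Pos⇒∣∣ gap))
                     (adjacent (λ e → t∉ (there (there (here (sym e))))) u≁t)
          not-negative : ∀ {l} → S l ≡ S t - S u → ¬ Pos (- S l)
          not-negative {l} e p = Pos-absurd (gap ⊕ p) (trans (cong (_+ - S l) (sym e)) (ℤₚ.+-inverseʳ (S l)))
          at-M : Mem (S t - S u) → ⊥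
          at-M (l , e) = check (l Finₚ.≟ M)
            where
            check : Dec (l ≡ M) → ⊥
            check (yes refl) = proj₂ z-u (subst (λ w → Mem (+ ∣ w ∣)) same (adjacent (λ f → t∉ (there (here (sym f)))) M≁t))
              where
              same : S M - S t ≡ S z - S u
              same = trans (cong (_- S t) e) (trans (eq (S t) (S u)) (cong (_- S u) (sym Sz≡0)))
                where eq : ∀ t u → t - u - t ≡ 0ℤ - u
                      eq = solve-∀
            check (no l≢M) = ≤⇒¬Pos (t-greatest l l∉) (Pos-cong Su<0 (trans (eq (S t) (S u)) (cong (_- S t) (sym e))))
              where
              eq : ∀ t u → - u ≡ t - u - t
              eq = solve-∀
              l∉ : l ∉ xs
              l∉ (here f) = not-z (subst Pos (sym e) gap) f
              l∉ (there (here f)) = l≢M f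
              l∉ (there (there (here refl))) = not-negative e Su<0
              l∉ (there (there (there (here refl)))) = not-negative e Sv<0

    0∉S : ¬ Mem 0ℤ
    0∉S (z , e) = ZeroElement.impossible z e

    S-injective : Injective _≡_ _≡_ S
    S-injective {i} {j} Si≡Sj with i Finₚ.≟ j
    ... | yes e = e
    ... | no i≢j with degree j
    ... | a , b , j-a , j-b , a≢b , _ = ⊥-elim (pick (a Finₚ.≟ i))
      where
      twin : NonAdj i j
      twin = i≢j , λ m → 0∉S (subst (λ w → Mem (+ ∣ w ∣)) (trans (cong (_- S j) Si≡Sj) (ℤₚ.+-inverseʳ (S j))) m)
      triangle : ∀ {l} → l ≢ i → NonAdj j l → ⊥
      triangle {l} l≢i na = triangle-free twin na
        ((λ e → l≢i (sym e)) , λ m → proj₂ na (subst (λ w → Mem (+ ∣ w - S l ∣)) Si≡Sj m))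
      pick : Dec (a ≡ i) → ⊥
      pick (no a≢i) = triangle a≢i j-a
      pick (yes refl) = triangle (λ e → a≢b (sym e)) j-b

    elements : List ℤ
    elements = tabulate S

    infix 4 _~_
    _~_ : ℤ → ℤ → Set
    _~_ = Adjacent (_∈ elements)

    Mem⇒∈ : ∀ {z} → Mem z → z ∈ elements
    Mem⇒∈ (l , refl) = ∈-tabulate⁺ {f = S} l

    ∈⇒Mem : ∀ {z} → z ∈ elements → Mem z
    ∈⇒Mem p with ∈-tabulate⁻ {f = S} p
    ... | l , e = l , sym e

    NonAdj⇒~ : ∀ {i j} → NonAdj i j → S i ~ S j
    NonAdj⇒~ {i} {j} na@(i≢j , ∉) = mk~ (Mem⇒∈ (i , refl)) (Mem⇒∈ (j , refl)) (λ e → i≢j (S-injective e))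
      (λ (mkQ p q) → ∉ (subst Mem (sym (Pos⇒∣∣ p)) (∈⇒Mem q)))
      (λ (mkQ p q) → proj₂ (NonAdj-sym na) (subst Mem (sym (Pos⇒∣∣ p)) (∈⇒Mem q)))

    ~⇒NonAdj : ∀ {i j} → S i ~ S j → NonAdj i j
    ~⇒NonAdj {i} {j} (mk~ _ _ n ∉ˡ ∉ʳ) = (λ { refl → n refl }) , λ m → by-sign m (sign (S i - S j))
      where
      by-sign : Mem (+ ∣ S i - S j ∣) → Pos (S i - S j) ⊎ S i - S j ≡ 0ℤ ⊎ Pos (- (S i - S j)) → ⊥
      by-sign m (inj₁ p) = ∉ˡ (mkQ p (Mem⇒∈ (subst Mem (Pos⇒∣∣ p) m)))
      by-sign m (inj₂ (inj₁ e)) = n (ℤₚ.i-j≡0⇒i≡j (S i) (S j) e)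
      by-sign m (inj₂ (inj₂ p)) = ∉ʳ (mkQ p′ (Mem⇒∈ (subst Mem
          (trans (cong +_ (ℤₚ.∣i-j∣≡∣j-i∣ (S i) (S j))) (Pos⇒∣∣ p′)) m)))
        where
        p′ : Pos (S j - S i)
        p′ = Pos-cong p (eq (S i) (S j))
          where eq : ∀ i j → - (i - j) ≡ j - i
                eq = solve-∀

    -- The colouring has to be total on the integers; `true` is an arbitrary default outside S.
    value-side : ℤ → Bool
    value-side z with Mem? z
    ... | yes (l , _) = side l
    ... | no _ = true

    value-side-S : ∀ i → value-side (S i) ≡ side i
    value-side-S i with Mem? (S i)
    ... | yes (l , e) = cong side (S-injective e)
    ... | no ∉ = ⊥-elim (∉ (i , refl))

    on-values : ∀ {z} {R : ℤ → Set} → (∀ i → R (S i)) → z ∈ elements → R z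
    on-values {R = R} r p with ∈⇒Mem p
    ... | i , refl = r i

    config : Config
    config = record
      { elements = elements
      ; 0∉ = λ p → 0∉S (∈⇒Mem p)
      ; degree = λ {x} p → on-values {R = λ x → ∃₂ λ y z → x ~ y × x ~ z × y ≢ z × (∀ {t} → x ~ t → t ≡ y ⊎ t ≡ z)} value-degree p
      ; triangle-free = value-triangle-free
      ; side = value-side
      ; side-~ = value-side-~
      ; side-mixed = mixed side-mixed
      ; fresh = λ xs lt → value-fresh xs lt
      ; maximum = value-maximum
      ; minimum = value-minimum
      }
      where
      value-degree : ∀ i → ∃₂ λ y z → S i ~ y × S i ~ z × y ≢ z × (∀ {t} → S i ~ t → t ≡ y ⊎ t ≡ z)
      value-degree i with degree i
      ... | a , b , ia , ib , a≢b , only = S a , S b , NonAdj⇒~ ia , NonAdj⇒~ ib , (λ e → a≢b (S-injective e)) , value-only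
        where
        value-only : ∀ {t} → S i ~ t → t ≡ S a ⊎ t ≡ S b
        value-only adj with ∈⇒Mem (Adjacent.∈ʳ adj)
        ... | l , refl with only (~⇒NonAdj adj)
        ... | inj₁ refl = inj₁ refl
        ... | inj₂ refl = inj₂ refl
      value-triangle-free : ∀ {x y z} → x ~ y → y ~ z → x ~ z → ⊥
      value-triangle-free p q r with ∈⇒Mem (Adjacent.∈ˡ p) | ∈⇒Mem (Adjacent.∈ʳ p) | ∈⇒Mem (Adjacent.∈ʳ q)
      ... | _ , refl | _ , refl | _ , refl = triangle-free (~⇒NonAdj p) (~⇒NonAdj q) (~⇒NonAdj r)
      value-side-~ : ∀ {x y} → x ~ y → value-side x ≡ value-side y
      value-side-~ p with ∈⇒Mem (Adjacent.∈ˡ p) | ∈⇒Mem (Adjacent.∈ʳ p)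
      ... | i , refl | j , refl = trans (value-side-S i) (trans (side-NonAdj (~⇒NonAdj p)) (sym (value-side-S j)))
      mixed : (∃₂ λ i j → side i ≢ side j) → ∃₂ λ x y → x ∈ elements × y ∈ elements × value-side x ≢ value-side y
      mixed (i , j , n) = S i , S j , Mem⇒∈ (i , refl) , Mem⇒∈ (j , refl) ,
        λ e → n (trans (sym (value-side-S i)) (trans e (value-side-S j)))
      value-fresh : ∀ xs → length xs ℕ.< 8 → ∃ λ t → t ∈ elements × t ∉ xs
      value-fresh xs lt with escape S S-injective ℤₚ._≟_ xs (ℕₚ.≤-trans lt size)
      ... | i , ∉ = S i , Mem⇒∈ (i , refl) , ∉
      compare : ∀ {i j} → i ℤ.≤ j → i ≡ j ⊎ Pos (j - i)
      compare {i} {j} le with sign (j - i)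
      ... | inj₁ p = inj₂ p
      ... | inj₂ (inj₁ e) = inj₁ (sym (ℤₚ.i-j≡0⇒i≡j j i e))
      ... | inj₂ (inj₂ p) = ⊥-elim (≤⇒¬Pos le (Pos-cong p (solve (i ∷ j ∷ []))))
      some-index : Fin k
      some-index = proj₁ (fresh-index [] (ℕ.s≤s ℕ.z≤n))
      value-maximum : ∃ λ M → M ∈ elements × (∀ {t} → t ∈ elements → t ≡ M ⊎ Pos (M - t))
      value-maximum with argmax S {λ i → i ≡ i} (λ i → yes refl) (some-index , refl)
      ... | M , _ , greatest = S M , Mem⇒∈ (M , refl) , on-values (λ i → compare (greatest i refl))
      value-minimum : ∃ λ m → m ∈ elements × (∀ {t} → t ∈ elements → t ≡ m ⊎ Pos (t - m))
      value-minimum with argmax (λ i → - S i) {λ i → i ≡ i} (λ i → yes refl) (some-index , refl)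
      ... | m , _ , least = S m , Mem⇒∈ (m , refl) , on-values (λ i → flip (compare (ℤₚ.neg-cancel-≤ (least i refl))))
        where
        flip : ∀ {i j} → i ≡ j ⊎ Pos (j - i) → j ≡ i ⊎ Pos (j - i)
        flip (inj₁ e) = inj₁ (sym e)
        flip (inj₂ p) = inj₂ p

    impossible : ⊥
    impossible = Refutation.impossible config

theorem2 : (m' : ℕ) → 4 ≤ suc m' → ¬ IsAutograph (GVertex m') (GAdj m')
theorem2 m′ (ℕ.s≤s 3≤m′) (k , S , π , adj⇔) = Contradiction.impossible two-regular
  where
  open Signature S
  open Cycle m′ 3≤m′
  open Bijection π using (to; injective; surjective)

  from : GVertex m′ → Fin k
  from v = proj₁ (surjective v)

  to-from : ∀ v → to (from v) ≡ v
  to-from v = proj₂ (surjective v) refl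

  from-injective : ∀ {u v} → from u ≡ from v → u ≡ v
  from-injective {u} {v} e = trans (sym (to-from u)) (trans (cong to e) (to-from v))

  -- The complement yields only the double negation of a cycle edge, which decidability removes.
  NonAdj⇒edge : ∀ {i j} → NonAdj i j → TwoCyclesAdj m′ (to i) (to j)
  NonAdj⇒edge {i} {j} (i≢j , ∉) = decidable-stable (TwoCycles? (to i) (to j))
    λ ¬e → ∉ (Equivalence.to (adj⇔ i j i≢j) ((λ e → i≢j (injective e)) , ¬e))

  edge⇒NonAdj : ∀ {i j} → TwoCyclesAdj m′ (to i) (to j) → NonAdj i j
  edge⇒NonAdj {i} {j} e = i≢j , λ m → proj₂ (Equivalence.from (adj⇔ i j i≢j) m) e
    where
    i≢j : i ≢ j
    i≢j refl = TwoCycles-irreflexive (to i) e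

  two-regular : TwoRegular
  two-regular = record
    -- Two cycles of at least four vertices each: their 4 + 4 vertices inject into the indices.
    { size = ℕₚ.≤-trans (ℕₚ.+-mono-≤ (ℕ.s≤s 3≤m′) (ℕ.s≤s 3≤m′))
        (Finₚ.injective⇒≤ {f = λ i → from (Fin.splitAt (suc m′) i)} λ {i} {j} e →
          trans (sym (Finₚ.join-splitAt (suc m′) (suc m′) i))
            (trans (cong (Fin.join (suc m′) (suc m′)) (from-injective e)) (Finₚ.join-splitAt (suc m′) (suc m′) j)))
    ; degree = index-degree
    ; triangle-free = λ p q r → TwoCycles-triangle-free _ _ _ (NonAdj⇒edge p) (NonAdj⇒edge q) (NonAdj⇒edge r)
    ; side = λ i → side (to i)
    ; side-NonAdj = λ p → TwoCycles-side _ _ (NonAdj⇒edge p)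
    ; side-mixed = from (inj₁ Fin.zero) , from (inj₂ Fin.zero) , λ e →
        true≢false (trans (sym (cong side (to-from (inj₁ Fin.zero)))) (trans e (cong side (to-from (inj₂ Fin.zero)))))
    }
    where
    true≢false : true ≢ false
    true≢false ()
    index-degree : ∀ i → ∃₂ λ j l → NonAdj i j × NonAdj i l × j ≢ l × (∀ {t} → NonAdj i t → t ≡ j ⊎ t ≡ l)
    index-degree i with TwoCycles-degree (to i)
    ... | v , w , ev , ew , v≢w , only = from v , from w ,
        edge⇒NonAdj (subst (TwoCyclesAdj m′ (to i)) (sym (to-from v)) ev) ,
        edge⇒NonAdj (subst (TwoCyclesAdj m′ (to i)) (sym (to-from w)) ew) ,
        (λ e → v≢w (from-injective e)) , index-only
      where
      index-only : ∀ {t} → NonAdj i t → t ≡ from v ⊎ t ≡ from w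
      index-only {t} na with only (to t) (NonAdj⇒edge na)
      ... | inj₁ e = inj₁ (injective (trans e (sym (to-from v))))
      ... | inj₂ e = inj₂ (injective (trans e (sym (to-from w))))
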